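{- Let $\mu$ be a Gibbs distribution on $[q]^V$ (for a graph $G=(V,E)$) satisfying $C$-coupling independence, and let $R>0$ be an integer. For any $\Lambda\subseteq V$ and any two partial configurations $\sigma,\tau\in[q]^\Lambda$ that disagree only at some vertex $v\in\Lambda$, there is a coupling $\mathcal C$ of $\mu^\sigma$ and $\mu^\tau$ such that $$\mathbb E_{(\sigma',\tau')\sim\mathcal C}\Big[\sum_{u\in S_R(v)}\mathbf 1[\sigma'(u)\ne\tau'(u)]\Big]\le 2C\left(\tfrac12\right)^{\lceil R/(2C)\rceil}.$$ As a consequence, $\mu$ satisfies total influence decay with rate $\delta(x)=2C\cdot 2^{ -\lceil x/(2C)\rceil}$, i.e. for all such $\sigma,\tau,v$ and every integer $\ell>0$, $\sum_{u\in S_\ell(v)}d_{TV}(\mu^\sigma_u,\mu^\tau_u)\le 2C\cdot2^{ -\lceil \ell/(2C)\rceil}$.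
   Context: The Gibbs distribution $\mu$ comes from a spin system on $G=(V,E)$: $\mu(\sigma)\propto\prod_{\{u,v\}\in E}A_E(\sigma(u),\sigma(v))\prod_{v}A_V(\sigma(v))$ with $A_E\in\mathbb{R}_{\ge0}^{q\times q}$, $A_V\in\mathbb{R}_{\ge0}^q$. For $\Lambda\subseteq V$ and a (possibly infeasible) $\sigma\in[q]^\Lambda$, $\mu^\sigma(\tau)\propto\mathbf 1[\tau|_\Lambda=\sigma]\prod_{v\notin\Lambda}A_V(\tau(v))\prod_{\{u,v\}\in E,u\notin\Lambda,v\in\Lambda}A_E(\tau(u),\sigma(v))\prod_{\{u,v\}\in E,u,v\notin\Lambda}A_E(\tau(u),\tau(v))$ for $\tau\in[q]^V$ (assumed well defined, i.e. the normaliser is positive), and $\mu^\sigma_u$ is its marginal at $u$. $C$-coupling independence: for every $\Lambda\subseteq V$ and $\sigma,\tau\in[q]^\Lambda$ differing in exactly one vertex, there is a coupling $(X,Y)$ of $\mu^\sigma,\mu^\tau$ with expected Hamming distance (number of vertices where $X,Y$ differ) at most $C$. $S_\ell(v)=\{u\in V:\mathrm{dist}_G(u,v)=\ell\}$ is the sphere of radius $\ell$ around $v$ in graph distance; $d_{TV}$ is total variation distance. -}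

module Defs where

open import Level using (Level; _⊔_) renaming (suc to lsuc)
open import Algebra.Bundles using (CommutativeRing)
open import Data.Fin using (Fin)
open import Data.Fin.Properties using (any?; all?) renaming (_≟_ to _≟ᶠ_; _<?_ to _<ᶠ?_)
open import Data.Fin.Subset using (Subset; _∈_)
open import Data.Fin.Subset.Properties using (_∈?_)
open import Data.List using (List; []; _∷_; foldr; map; filter; allFin; cartesianProduct; cartesianProductWith)
open import Data.Nat using (ℕ; zero; suc; z≤n; s≤s; _>_) renaming (_<_ to _<ℕ_; _≤_ to _≤ℕ_)
open import Data.Nat.Properties using (allUpTo?)
open import Data.Product using (Σ; ∃; _×_; _,_; proj₁; proj₂)
open import Data.Vec using (Vec; []; _∷_; lookup)
open import Relation.Binary using (Rel; Decidable; Symmetric; Irreflexive; IsDecTotalOrder)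
open import Relation.Binary.PropositionalEquality using (_≡_; _≢_; refl)
open import Relation.Nullary using (¬_; Dec; yes; no; ¬?; _×-dec_; contradiction)
import Algebra.Properties.Monoid.Mult as Mult
import Algebra.Properties.Semiring.Exp as Exp
import Relation.Binary.Construct.NonStrictToStrict as ToStrict

private
  variable
    p : Level

least : {P : ℕ → Set p} → (∀ n → Dec (P n)) → ∀ n → P n →
        ∃ λ k → P k × (∀ m → P m → k ≤ℕ m)
least P? zero Pn = zero , Pn , λ _ _ → z≤n
least {P = P} P? (suc n) Pn with P? zero
... | yes P0 = zero , P0 , λ _ _ → z≤n
... | no ¬P0 with least {P = λ m → P (suc m)} (λ m → P? (suc m)) n Pn
...   | k , Pk , min = suc k , Pk , λ where
        zero    P0 → contradiction P0 ¬P0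
        (suc m) Pm → s≤s (min m Pm)

-- The standard library has no real numbers; scalars range over an arbitrary
-- Archimedean ordered field.  Classically ℝ is one (order and equality being
-- decidable by excluded middle), so results for all K include the real case.
-- The value of 0# ⁻¹ is unspecified.
record ArchimedeanOrderedField c ℓ₁ ℓ₂ : Set (lsuc (c ⊔ ℓ₁ ⊔ ℓ₂)) where
  infix  8 _⁻¹
  infixl 7 _/_
  infix  4 _≤_ _<_

  field
    commutativeRing : CommutativeRing c ℓ₁

  open CommutativeRing commutativeRing public
    hiding (_≉_)

  field
    _≤_             : Rel Carrier ℓ₂
    isDecTotalOrder : IsDecTotalOrder _≈_ _≤_
    _⁻¹             : Carrier → Carrier
    ⁻¹-cong         : ∀ {x y} → x ≈ y → x ⁻¹ ≈ y ⁻¹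
    0≉1             : ¬ (0# ≈ 1#)
    ⁻¹-inverse      : ∀ x → ¬ (x ≈ 0#) → x * x ⁻¹ ≈ 1#
    +-mono-≤        : ∀ {x y} z → x ≤ y → x + z ≤ y + z
    *-nonNeg        : ∀ {x y} → 0# ≤ x → 0# ≤ y → 0# ≤ x * y

  module Order = IsDecTotalOrder isDecTotalOrder

  open Mult +-monoid public using () renaming (_×_ to _·_)
  open Exp semiring public using (_^_)

  fromℕ : ℕ → Carrier
  fromℕ n = n · 1#

  field
    archimedean : ∀ x → ∃ λ n → x ≤ fromℕ n

  _<_ : Rel Carrier (ℓ₁ ⊔ ℓ₂)
  _<_ = ToStrict._<_ _≈_ _≤_

  _/_ : Carrier → Carrier → Carrier
  x / y = x * y ⁻¹

  2# ½ : Carrier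
  2# = fromℕ 2
  ½  = 1# / 2#

  ceiling : ∀ x → ∃ λ n → x ≤ fromℕ n × (∀ m → x ≤ fromℕ m → n ≤ℕ m)
  ceiling x = least (λ n → x Order.≤? fromℕ n) (proj₁ (archimedean x)) (proj₂ (archimedean x))

  -- Truncated at 0, so this is the usual ceiling for x > -1.
  ⌈_⌉ : Carrier → ℕ
  ⌈ x ⌉ = proj₁ (ceiling x)

  ∣_∣ : Carrier → Carrier
  ∣ x ∣ with 0# Order.≤? x
  ... | yes _ = x
  ... | no  _ = - x

  ∑ ∏ : ∀ {a} {A : Set a} → List A → (A → Carrier) → Carrier
  ∑ xs f = foldr _+_ 0# (map f xs)
  ∏ xs f = foldr _*_ 1# (map f xs)

  𝟙 : {P : Set p} → Dec P → Carrier
  𝟙 (yes _) = 1#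
  𝟙 (no  _) = 0#

  factorIf : {P : Set p} → Dec P → (P → Carrier) → Carrier
  factorIf (yes x) f = f x
  factorIf (no  _) f = 1#

record Graph (n : ℕ) : Set₁ where
  field
    Adj        : Rel (Fin n) _
    adj?       : Decidable Adj
    adj-sym    : Symmetric Adj
    adj-irrefl : Irreflexive _≡_ Adj

module _ {n : ℕ} (G : Graph n) where
  open Graph G

  data Walk : ℕ → Fin n → Fin n → Set where
    here : ∀ {u} → Walk 0 u u
    step : ∀ {k u w v} → Adj u w → Walk k w v → Walk (suc k) u v

  walk? : ∀ k u v → Dec (Walk k u v)
  walk? zero u v with u ≟ᶠ v
  ... | yes refl = yes here
  ... | no  u≢v  = no λ where here → u≢v refl
  walk? (suc k) u v with any? (λ w → adj? u w ×-dec walk? k w v)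
  ... | yes (w , a , p) = yes (step a p)
  ... | no  none        = no λ where (step a p) → none (_ , a , p)

  -- "dist u v is (finite and) equal to ℓ"
  HasDist : Fin n → Fin n → ℕ → Set
  HasDist u v ℓ = Walk ℓ u v × (∀ {k} → k <ℕ ℓ → ¬ Walk k u v)

  hasDist? : ∀ u v ℓ → Dec (HasDist u v ℓ)
  hasDist? u v ℓ = walk? ℓ u v ×-dec allUpTo? (λ k → ¬? (walk? k u v)) ℓ

  sphere : ℕ → Fin n → List (Fin n)
  sphere ℓ v = filter (λ u → hasDist? u v ℓ) (allFin n)

  -- Each undirected edge is listed once, as the pair with u < v.
  edges : List (Fin n × Fin n)
  edges = filter (λ (u , v) → (u <ᶠ? v) ×-dec adj? u v) (cartesianProduct (allFin n) (allFin n))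

Config : ℕ → ℕ → Set
Config q n = Vec (Fin q) n

configs : ∀ q n → List (Config q n)
configs q zero    = [] ∷ []
configs q (suc n) = cartesianProductWith _∷_ (allFin q) (configs q n)

PartialConfig : ∀ {n} → ℕ → Subset n → Set
PartialConfig {n} q Λ = (v : Fin n) → .(v ∈ Λ) → Fin q

module _ {n q : ℕ} {Λ : Subset n} where

  Extends : Config q n → PartialConfig q Λ → Set
  Extends τ σ = ∀ v → (v∈Λ : v ∈ Λ) → lookup τ v ≡ σ v v∈Λ

  extends? : ∀ τ σ → Dec (Extends τ σ)
  extends? τ σ = all? at
    where
    at : ∀ v → Dec ((v∈Λ : v ∈ Λ) → lookup τ v ≡ σ v v∈Λ)
    at v with v ∈? Λ
    ... | no  v∉Λ = yes λ v∈Λ → contradiction v∈Λ v∉Λ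
    ... | yes v∈Λ with lookup τ v ≟ᶠ σ v v∈Λ
    ...   | yes eq = yes λ _ → eq
    ...   | no  ne = no λ f → ne (f v∈Λ)

  DifferExactlyAt : PartialConfig q Λ → PartialConfig q Λ → Fin n → Set
  DifferExactlyAt σ τ v =
    Σ (v ∈ Λ) (λ v∈Λ → σ v v∈Λ ≢ τ v v∈Λ) ×
    (∀ u → (u∈Λ : u ∈ Λ) → u ≢ v → σ u u∈Λ ≡ τ u u∈Λ)

module _ {c ℓ₁ ℓ₂} (K : ArchimedeanOrderedField c ℓ₁ ℓ₂) where
  open ArchimedeanOrderedField K

  -- Symmetry of A_E is what makes A_E(σ(u),σ(v)) a function of the
  -- undirected edge {u,v}.
  record SpinSystem (q : ℕ) : Set (c ⊔ ℓ₁ ⊔ ℓ₂) where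
    field
      A-E        : Fin q → Fin q → Carrier
      A-V        : Fin q → Carrier
      A-E-sym    : ∀ a b → A-E a b ≈ A-E b a
      A-E-nonNeg : ∀ a b → 0# ≤ A-E a b
      A-V-nonNeg : ∀ a → 0# ≤ A-V a

module Gibbs {c ℓ₁ ℓ₂} (K : ArchimedeanOrderedField c ℓ₁ ℓ₂) {n q : ℕ} (G : Graph n) (S : SpinSystem K q) where
  open ArchimedeanOrderedField K
  open Graph G
  open SpinSystem S

  module _ {Λ : Subset n} (σ : PartialConfig q Λ) where

    weight : Config q n → Carrier
    weight τ = 𝟙 (extends? τ σ) * (vertexPart * (boundaryPart * interiorPart))
      where
      V = allFin n

      vertexPart boundaryPart interiorPart : Carrier
      vertexPart   = ∏ V λ v →
                       factorIf (¬? (v ∈? Λ)) λ _ → A-V (lookup τ v)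
      boundaryPart = ∏ V λ u → ∏ V λ v →
                       factorIf (adj? u v ×-dec (¬? (u ∈? Λ) ×-dec (v ∈? Λ))) λ (_ , _ , v∈Λ) →
                         A-E (lookup τ u) (σ v v∈Λ)
      interiorPart = ∏ (edges G) λ (u , v) →
                       factorIf (¬? (u ∈? Λ) ×-dec ¬? (v ∈? Λ)) λ _ →
                         A-E (lookup τ u) (lookup τ v)

    normaliser : Carrier
    normaliser = ∑ (configs q n) weight

    -- μ^σ; the unconditioned Gibbs distribution is the case Λ = ∅.
    μ : Config q n → Carrier
    μ τ = weight τ / normaliser

    marginal : Fin n → Fin q → Carrier
    marginal u a = ∑ (configs q n) λ τ → 𝟙 (lookup τ u ≟ᶠ a) * μ τ

  WellDefined : Set (ℓ₁ ⊔ ℓ₂)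
  WellDefined = ∀ (Λ : Subset n) (σ : PartialConfig q Λ) → 0# < normaliser σ

  -- Total mass 1 of the joint law follows from the marginal conditions.
  record Coupling (μ₁ μ₂ : Config q n → Carrier) : Set (c ⊔ ℓ₁ ⊔ ℓ₂) where
    field
      joint       : Config q n → Config q n → Carrier
      nonNeg      : ∀ X Y → 0# ≤ joint X Y
      marginal-₁  : ∀ X → ∑ (configs q n) (λ Y → joint X Y) ≈ μ₁ X
      marginal-₂  : ∀ Y → ∑ (configs q n) (λ X → joint X Y) ≈ μ₂ Y

    𝔼 : (Config q n → Config q n → Carrier) → Carrier
    𝔼 f = ∑ (configs q n) λ X → ∑ (configs q n) λ Y → joint X Y * f X Y

  disagreements : List (Fin n) → Config q n → Config q n → Carrier
  disagreements us X Y = ∑ us λ u → 𝟙 (¬? (lookup X u ≟ᶠ lookup Y u))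

  hamming : Config q n → Config q n → Carrier
  hamming = disagreements (allFin n)

  CouplingIndependence : Carrier → Set (c ⊔ ℓ₁ ⊔ ℓ₂)
  CouplingIndependence C =
    ∀ (Λ : Subset n) (σ τ : PartialConfig q Λ) → ∃ (DifferExactlyAt σ τ) →
    Σ (Coupling (μ σ) (μ τ)) λ 𝒞 → Coupling.𝔼 𝒞 hamming ≤ C

  dTV : (Fin q → Carrier) → (Fin q → Carrier) → Carrier
  dTV μ₁ μ₂ = ½ * ∑ (allFin q) λ a → ∣ μ₁ a - μ₂ a ∣

  TotalInfluenceDecay : (Carrier → Carrier) → Set ℓ₂
  TotalInfluenceDecay δ =
    ∀ (Λ : Subset n) (σ τ : PartialConfig q Λ) (v : Fin n) → DifferExactlyAt σ τ v →
    ∀ (ℓ : ℕ) → ℓ > 0 →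
    ∑ (sphere G ℓ v) (λ u → dTV (marginal σ u) (marginal τ u)) ≤ δ (fromℕ ℓ)

{-# OPTIONS --safe #-}

-- The bound is proved, by strong induction on R, for the expected number of
-- disagreements at distance at least R from v.  For R ≤ 2C the coupling given
-- by C-coupling independence suffices.  Otherwise that coupling has at most C
-- expected disagreements, one of them at v, so some sphere S_r(v) with
-- 1 ≤ r ≤ 2C carries at most ½ of them.  Reveal both samples on the ball of
-- radius r and resample the rest: disagreements strictly inside the ball have
-- no influence outside it, and each disagreement on S_r(v) is coupled
-- recursively, at distance R - r, along a path changing one vertex at a time.
-- The expected number of disagreements is thus halved whenever R drops by at
-- most 2C.  Total influence decay follows since total variation distance is
-- at most the disagreement probability of any coupling.

module Submission where

open import Defs
open import Algebra.Bundles using (CommutativeMonoid)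
open import Data.Empty using (⊥-elim)
open import Data.Fin using (Fin)
open import Data.Fin.Properties using (<-cmp) renaming (_≟_ to _≟ᶠ_; _<?_ to _<ᶠ?_)
open import Data.Fin.Subset using (Subset; _∈_; _∉_; _⊆_; _∪_)
open import Data.Fin.Subset.Properties using (_∈?_; x∈p∪q⁺; x∈p∪q⁻; p⊆p∪q)
open import Data.List using (List; []; _∷_; _++_; foldr; map; filter; cartesianProduct; allFin)
open import Data.List.Membership.Propositional using () renaming (_∈_ to _∈ₗ_; _∉_ to _∉ₗ_)
open import Data.List.Membership.Propositional.Properties using (∈-allFin; ∈-cartesianProductWith⁺)
open import Data.List.Relation.Unary.All using (All; []; _∷_)
open import Data.List.Relation.Unary.AllPairs using ([]; _∷_)
open import Data.List.Relation.Unary.Any using (here; there)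
open import Data.List.Relation.Unary.Unique.Propositional using (Unique)
open import Data.List.Relation.Unary.Unique.Propositional.Properties using (allFin⁺; cartesianProductWith⁺)
open import Data.Nat using (ℕ; zero; suc; _∸_; z≤n; s≤s; pred; _>_) renaming (_+_ to _+ℕ_; _≤_ to _≤ℕ_; _<_ to _<ℕ_)
open import Data.Nat.Induction using (<-rec)
open import Data.Nat.Properties using (allUpTo?; m<1+n⇒m<n∨m≡n; m∸n+n≡m; ∸-monoʳ-<)
open import Data.Product using (Σ; _×_; _,_; proj₁; proj₂; ∃)
open import Data.Sum using (_⊎_; inj₁; inj₂)
open import Data.Vec using ([]; _∷_; lookup; tabulate; _[_]≔_)
open import Data.Vec.Properties using (≡-dec; ∷-injective; lookup∘tabulate; tabulate∘lookup; tabulate-cong; lookup∘update; lookup∘update′; lookup⇒[]=; []=⇒lookup)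
open import Relation.Binary using (DecidableEquality; Poset; tri<; tri≈; tri>)
open import Relation.Binary.PropositionalEquality as ≡ using (_≡_; _≢_)
open import Relation.Nullary using (¬_; Dec; yes; no; contradiction; ¬?; _×-dec_; does)
open import Relation.Nullary.Decidable using (decidable-stable; dec-true)
open import Relation.Unary using (Pred) renaming (Decidable to Decidable₁)
import Algebra.Properties.AbelianGroup as AbelianGroupProperties
import Algebra.Properties.CommutativeSemigroup as CommutativeSemigroupProperties
import Algebra.Properties.Monoid.Mult as MultProperties
import Algebra.Properties.Ring as RingProperties
import Data.Nat.Properties as ℕ
import Relation.Binary.Reasoning.PartialOrder as PosetReasoning
import Relation.Binary.Reasoning.Setoid as SetoidReasoning

-- The window 2C and the factor ½ are tied together: if every shell at a positive radius below 2C
-- carried more than ½, these shells and the unit at v would together exceed C. Lowering the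
-- distance by at most 2C lowers the exponent by at most one, which the factor ½ repays. Dividing by
-- 2C is legitimate because the disagreement at v alone forces C ≥ 1. The configurations on a path
-- between two revealed samples mix values of both and may well have weight zero. The recursion
-- therefore needs a distribution and a coupling bound for every pinning, feasible or not, which is
-- what `WellDefined` and `CouplingIndependence` supply. Revealing a sample on a larger set is never
-- expressed by dividing by the probability of an event. It is a kernel that keeps the revealed
-- values and redraws everything else, and its correctness is a detailed balance identity between
-- products of weights, valid also where weights vanish.

-- Iterated operations over lists in a commutative monoid.

module BigOperator {c ℓ} (M : CommutativeMonoid c ℓ) where
  open CommutativeMonoid M
  open CommutativeSemigroupProperties commutativeSemigroup using (interchange)
  open SetoidReasoning setoid

  ⨁ : ∀ {a} {A : Set a} → List A → (A → Carrier) → Carrier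
  ⨁ xs f = foldr _∙_ ε (map f xs)

  module _ {a} {A : Set a} where

    ⨁-cong : ∀ (xs : List A) {f g} → (∀ x → f x ≈ g x) → ⨁ xs f ≈ ⨁ xs g
    ⨁-cong []       f≈g = refl
    ⨁-cong (x ∷ xs) f≈g = ∙-cong (f≈g x) (⨁-cong xs f≈g)

    ⨁-ε : ∀ (xs : List A) {f} → (∀ x → f x ≈ ε) → ⨁ xs f ≈ ε
    ⨁-ε []       f≈ε = refl
    ⨁-ε (x ∷ xs) f≈ε = trans (∙-cong (f≈ε x) (⨁-ε xs f≈ε)) (identityˡ ε)

    ⨁-∙ : ∀ (xs : List A) f g → ⨁ xs (λ x → f x ∙ g x) ≈ ⨁ xs f ∙ ⨁ xs g
    ⨁-∙ []       f g = sym (identityˡ ε)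
    ⨁-∙ (x ∷ xs) f g = trans (∙-congˡ (⨁-∙ xs f g)) (interchange _ _ _ _)

    -- Lets a sum or product over a filtered list, such as `sphere` or `edges`, run over all
    -- vertices or pairs, with the discarded terms replaced by the unit.
    ⨁-filter : ∀ {p} {P : Pred A p} (P? : Decidable₁ P) xs {f g} →
               (∀ {x} → P x → f x ≈ g x) → (∀ {x} → ¬ P x → g x ≈ ε) →
               ⨁ (filter P? xs) f ≈ ⨁ xs g
    ⨁-filter P? []       on off = refl
    ⨁-filter P? (x ∷ xs) on off with P? x
    ... | yes Px = ∙-cong (on Px) (⨁-filter P? xs on off)
    ... | no ¬Px = trans (⨁-filter P? xs on off) (sym (trans (∙-congʳ (off ¬Px)) (identityˡ _)))

    ⨁-++ : ∀ (xs ys : List A) f → ⨁ (xs ++ ys) f ≈ ⨁ xs f ∙ ⨁ ys f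
    ⨁-++ []       ys f = sym (identityˡ _)
    ⨁-++ (x ∷ xs) ys f = trans (∙-congˡ (⨁-++ xs ys f)) (sym (assoc _ _ _))

  module _ {a b} {A : Set a} {B : Set b} where

    ⨁-swap : ∀ (xs : List A) (ys : List B) (f : A → B → Carrier) →
             ⨁ xs (λ x → ⨁ ys (f x)) ≈ ⨁ ys (λ y → ⨁ xs (λ x → f x y))
    ⨁-swap []       ys f = sym (⨁-ε ys λ _ → refl)
    ⨁-swap (x ∷ xs) ys f = trans (∙-congˡ (⨁-swap xs ys f)) (sym (⨁-∙ ys _ _))

    ⨁-map : ∀ (h : A → B) xs f → ⨁ (map h xs) f ≡ ⨁ xs (λ x → f (h x))
    ⨁-map h []       f = ≡.refl
    ⨁-map h (x ∷ xs) f = ≡.cong (f (h x) ∙_) (⨁-map h xs f)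

  module _ {a b} {A : Set a} {B : Set b} where

    ⨁-cartesianProduct : ∀ (xs : List A) (ys : List B) f →
                         ⨁ (cartesianProduct xs ys) f ≈ ⨁ xs (λ x → ⨁ ys (λ y → f (x , y)))
    ⨁-cartesianProduct []       ys f = refl
    ⨁-cartesianProduct (x ∷ xs) ys f = begin
      ⨁ (map (x ,_) ys ++ cartesianProduct xs ys) f          ≈⟨ ⨁-++ (map (x ,_) ys) _ f ⟩
      ⨁ (map (x ,_) ys) f ∙ ⨁ (cartesianProduct xs ys) f     ≈⟨ ∙-cong (reflexive (⨁-map (x ,_) ys f)) (⨁-cartesianProduct xs ys f) ⟩
      ⨁ ys (λ y → f (x , y)) ∙ ⨁ xs (λ x → ⨁ ys (λ y → f (x , y))) ∎

-- Ordered-field inequalities, powers of one half, ceilings and indicators.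

module OrderedFieldProperties {c ℓ₁ ℓ₂} (K : ArchimedeanOrderedField c ℓ₁ ℓ₂) where
  open ArchimedeanOrderedField K
  open AbelianGroupProperties +-abelianGroup using () renaming (⁻¹-involutive to -‿involutive)
  open RingProperties ring using (-‿distribˡ-*)
  open MultProperties +-monoid using (×-homo-+)
  open BigOperator +-commutativeMonoid public
    using () renaming (⨁-cong to ∑-cong; ⨁-ε to ∑-zero; ⨁-∙ to ∑-+; ⨁-filter to ∑-filter; ⨁-swap to ∑-swap)
  open BigOperator *-commutativeMonoid public
    using () renaming (⨁-cong to ∏-cong; ⨁-∙ to ∏-*; ⨁-filter to ∏-filter; ⨁-swap to ∏-swap; ⨁-cartesianProduct to ∏-cartesianProduct)

  poset : Poset c ℓ₁ ℓ₂
  poset = record { isPartialOrder = Order.isPartialOrder }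

  module ≤-Reasoning = PosetReasoning poset
  open ≤-Reasoning

  ≤-respʳ : ∀ {x y z} → y ≈ z → x ≤ y → x ≤ z
  ≤-respʳ y≈z x≤y = Order.trans x≤y (Order.reflexive y≈z)

  ≤-respˡ : ∀ {x y z} → y ≈ z → y ≤ x → z ≤ x
  ≤-respˡ y≈z y≤x = Order.trans (Order.reflexive (sym y≈z)) y≤x

  ≰⇒≥ : ∀ {x y} → ¬ (x ≤ y) → y ≤ x
  ≰⇒≥ {x} {y} x≰y with Order.total x y
  ... | inj₁ x≤y = contradiction x≤y x≰y
  ... | inj₂ y≤x = y≤x

  +-mono : ∀ {w x y z} → w ≤ x → y ≤ z → w + y ≤ x + z
  +-mono {w} {x} {y} {z} w≤x y≤z = begin
    w + y ≤⟨ +-mono-≤ y w≤x ⟩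
    x + y ≈⟨ +-comm x y ⟩
    y + x ≤⟨ +-mono-≤ x y≤z ⟩
    z + x ≈⟨ +-comm z x ⟩
    x + z ∎

  x≤y+x : ∀ {x y} → 0# ≤ y → x ≤ y + x
  x≤y+x 0≤y = ≤-respˡ (+-identityˡ _) (+-mono-≤ _ 0≤y)

  x≤x+y : ∀ {x y} → 0# ≤ y → x ≤ x + y
  x≤x+y 0≤y = ≤-respʳ (+-comm _ _) (x≤y+x 0≤y)

  +-nonNeg : ∀ {x y} → 0# ≤ x → 0# ≤ y → 0# ≤ x + y
  +-nonNeg 0≤x 0≤y = ≤-respˡ (+-identityˡ 0#) (+-mono 0≤x 0≤y)

  x-y+y≈x : ∀ x y → (x - y) + y ≈ x
  x-y+y≈x x y = trans (+-assoc x (- y) y) (trans (+-congˡ (-‿inverseˡ y)) (+-identityʳ x))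

  x≤y⇒0≤y-x : ∀ {x y} → x ≤ y → 0# ≤ y - x
  x≤y⇒0≤y-x {x} {y} x≤y = ≤-respˡ (-‿inverseʳ x) (+-mono-≤ (- x) x≤y)

  x≤y+z⇒x-y≤z : ∀ {x y z} → x ≤ y + z → x - y ≤ z
  x≤y+z⇒x-y≤z {x} {y} {z} x≤y+z = begin
    x - y         ≤⟨ +-mono-≤ (- y) x≤y+z ⟩
    (y + z) - y   ≈⟨ +-congʳ (+-comm y z) ⟩
    (z + y) - y   ≈⟨ +-assoc z y (- y) ⟩
    z + (y - y)   ≈⟨ +-congˡ (-‿inverseʳ y) ⟩
    z + 0#        ≈⟨ +-identityʳ z ⟩
    z             ∎

  +-cancelʳ-≤ : ∀ {x y} z → x + z ≤ y + z → x ≤ y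
  +-cancelʳ-≤ {x} {y} z x+z≤y+z = begin
    x             ≈⟨ x-y+y≈x x (- z) ⟨
    (x - - z) - z ≈⟨ +-congʳ (+-congˡ (-‿involutive z)) ⟩
    (x + z) - z   ≤⟨ x≤y+z⇒x-y≤z (≤-respʳ (+-comm y z) x+z≤y+z) ⟩
    y             ∎

  *-monoˡ : ∀ {x y} z → 0# ≤ z → x ≤ y → z * x ≤ z * y
  *-monoˡ {x} {y} z 0≤z x≤y = begin
    z * x                 ≤⟨ x≤y+x (*-nonNeg 0≤z (x≤y⇒0≤y-x x≤y)) ⟩
    z * (y - x) + z * x   ≈⟨ distribˡ z (y - x) x ⟨
    z * ((y - x) + x)     ≈⟨ *-congˡ (x-y+y≈x y x) ⟩
    z * y                 ∎

  *-monoʳ : ∀ {x y} z → 0# ≤ z → x ≤ y → x * z ≤ y * z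
  *-monoʳ {x} {y} z 0≤z x≤y = begin
    x * z ≈⟨ *-comm x z ⟩
    z * x ≤⟨ *-monoˡ z 0≤z x≤y ⟩
    z * y ≈⟨ *-comm z y ⟩
    y * z ∎

  0≤1 : 0# ≤ 1#
  0≤1 with Order.total 0# 1#
  ... | inj₁ 0≤1 = 0≤1
  ... | inj₂ 1≤0 = begin
    0#                  ≤⟨ *-nonNeg 0≤-1 0≤-1 ⟩
    - 1# * - 1#         ≈⟨ -‿distribˡ-* 1# (- 1#) ⟨
    - (1# * - 1#)       ≈⟨ -‿cong (*-identityˡ (- 1#)) ⟩
    - - 1#              ≈⟨ -‿involutive 1# ⟩
    1#                  ∎
    where
    0≤-1 : 0# ≤ - 1#
    0≤-1 = ≤-respʳ (+-identityˡ _) (x≤y⇒0≤y-x 1≤0)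

  1≰0 : ¬ (1# ≤ 0#)
  1≰0 1≤0 = 0≉1 (Order.antisym 0≤1 1≤0)

  fromℕ-nonNeg : ∀ m → 0# ≤ fromℕ m
  fromℕ-nonNeg zero    = Order.refl
  fromℕ-nonNeg (suc m) = +-nonNeg 0≤1 (fromℕ-nonNeg m)

  fromℕ-+ : ∀ m n → fromℕ (m +ℕ n) ≈ fromℕ m + fromℕ n
  fromℕ-+ = ×-homo-+ 1#

  fromℕ-mono : ∀ {m n} → m ≤ℕ n → fromℕ m ≤ fromℕ n
  fromℕ-mono {n = n} z≤n = fromℕ-nonNeg n
  fromℕ-mono (s≤s m≤n) = +-mono Order.refl (fromℕ-mono m≤n)

  ≥1⇒≉0 : ∀ {x} → 1# ≤ x → ¬ (x ≈ 0#)
  ≥1⇒≉0 1≤x x≈0 = 1≰0 (≤-respʳ x≈0 1≤x)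

  ⁻¹-nonNeg : ∀ {x} → 0# ≤ x → ¬ (x ≈ 0#) → 0# ≤ x ⁻¹
  ⁻¹-nonNeg {x} 0≤x x≉0 with Order.total 0# (x ⁻¹)
  ... | inj₁ 0≤x⁻¹ = 0≤x⁻¹
  ... | inj₂ x⁻¹≤0 = contradiction 1≤0 1≰0
    where
    1≤0 : 1# ≤ 0#
    1≤0 = begin
      1#        ≈⟨ ⁻¹-inverse x x≉0 ⟨
      x * x ⁻¹  ≤⟨ *-monoˡ x 0≤x x⁻¹≤0 ⟩
      x * 0#    ≈⟨ zeroʳ x ⟩
      0#        ∎

  2#≥1 : 1# ≤ 2#
  2#≥1 = x≤x+y (fromℕ-nonNeg 1)

  2*½≈1 : 2# * ½ ≈ 1#
  2*½≈1 = trans (*-congˡ (*-identityˡ _)) (⁻¹-inverse 2# (≥1⇒≉0 2#≥1))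

  0≤½ : 0# ≤ ½
  0≤½ = *-nonNeg 0≤1 (⁻¹-nonNeg (fromℕ-nonNeg 2) (≥1⇒≉0 2#≥1))

  2*x≈x+x : ∀ x → 2# * x ≈ x + x
  2*x≈x+x x = begin-equality
    (1# + (1# + 0#)) * x ≈⟨ *-congʳ (+-congˡ (+-identityʳ 1#)) ⟩
    (1# + 1#) * x        ≈⟨ distribʳ x 1# 1# ⟩
    1# * x + 1# * x      ≈⟨ +-cong (*-identityˡ x) (*-identityˡ x) ⟩
    x + x                ∎

  ½+½≈1 : ½ + ½ ≈ 1#
  ½+½≈1 = trans (sym (2*x≈x+x ½)) 2*½≈1

  ½≤1 : ½ ≤ 1#
  ½≤1 = ≤-respʳ ½+½≈1 (x≤x+y 0≤½)

  ½*2x≈x : ∀ x → ½ * (2# * x) ≈ x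
  ½*2x≈x x = begin-equality
    ½ * (2# * x) ≈⟨ *-assoc ½ 2# x ⟨
    (½ * 2#) * x ≈⟨ *-congʳ (trans (*-comm ½ 2#) 2*½≈1) ⟩
    1# * x       ≈⟨ *-identityˡ x ⟩
    x            ∎

  ½^-nonNeg : ∀ k → 0# ≤ ½ ^ k
  ½^-nonNeg zero    = 0≤1
  ½^-nonNeg (suc k) = *-nonNeg 0≤½ (½^-nonNeg k)

  ½^-≤1 : ∀ k → ½ ^ k ≤ 1#
  ½^-≤1 zero    = Order.refl
  ½^-≤1 (suc k) = begin
    ½ * ½ ^ k ≤⟨ *-monoˡ ½ 0≤½ (½^-≤1 k) ⟩
    ½ * 1#    ≈⟨ *-identityʳ ½ ⟩
    ½         ≤⟨ ½≤1 ⟩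
    1#        ∎

  ½^-antitone : ∀ {j k} → j ≤ℕ k → ½ ^ k ≤ ½ ^ j
  ½^-antitone {k = k} z≤n = ½^-≤1 k
  ½^-antitone (s≤s j≤k)   = *-monoˡ ½ 0≤½ (½^-antitone j≤k)

  ∣∣-≤ : ∀ {x y} → x ≤ y → - x ≤ y → ∣ x ∣ ≤ y
  ∣∣-≤ {x} x≤y -x≤y with 0# Order.≤? x
  ... | yes _ = x≤y
  ... | no  _ = -x≤y

  ⌈⌉-upper : ∀ x → x ≤ fromℕ ⌈ x ⌉
  ⌈⌉-upper x = proj₁ (proj₂ (ceiling x))

  ⌈⌉-least : ∀ {x} m → x ≤ fromℕ m → ⌈ x ⌉ ≤ℕ m
  ⌈⌉-least {x} = proj₂ (proj₂ (ceiling x))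

  -- The inverse of x, except that 0# is sent to 0#: this keeps it nonnegative
  -- on nonnegative arguments, whereas 0# ⁻¹ is unspecified.
  inv : Carrier → Carrier
  inv x with x Order.≟ 0#
  ... | yes _ = 0#
  ... | no  _ = x ⁻¹

  inv-nonNeg : ∀ {x} → 0# ≤ x → 0# ≤ inv x
  inv-nonNeg {x} 0≤x with x Order.≟ 0#
  ... | yes _  = Order.refl
  ... | no x≉0 = ⁻¹-nonNeg 0≤x x≉0

  -- If y is zero, x is squeezed to zero as well, so the identity survives the default value of
  -- `inv`.
  inv-absorb : ∀ {x y} → 0# ≤ x → x ≤ y → x * inv y * y ≈ x
  inv-absorb {x} {y} 0≤x x≤y with y Order.≟ 0#
  ... | yes y≈0 = trans (trans (*-congʳ (zeroʳ x)) (zeroˡ y)) (sym (Order.antisym (≤-respʳ y≈0 x≤y) 0≤x))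
  ... | no  y≉0 = trans (*-assoc x _ y) (trans (*-congˡ (trans (*-comm _ y) (⁻¹-inverse y y≉0))) (*-identityʳ x))

  module _ {p} {P : Set p} where

    𝟙-yes : (d : Dec P) → P → 𝟙 d ≈ 1#
    𝟙-yes (yes _)  _ = refl
    𝟙-yes (no ¬p)  p = contradiction p ¬p

    𝟙-no : (d : Dec P) → ¬ P → 𝟙 d ≈ 0#
    𝟙-no (yes p) ¬p = contradiction p ¬p
    𝟙-no (no _)  _  = refl

    𝟙-nonNeg : (d : Dec P) → 0# ≤ 𝟙 d
    𝟙-nonNeg (yes _) = 0≤1
    𝟙-nonNeg (no  _) = Order.refl

    𝟙-≤1 : (d : Dec P) → 𝟙 d ≤ 1#
    𝟙-≤1 (yes _) = Order.refl
    𝟙-≤1 (no  _) = 0≤1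

    factorIf-cong : (d : Dec P) {f g : P → Carrier} → (∀ p → f p ≈ g p) → factorIf d f ≈ factorIf d g
    factorIf-cong (yes p) f≈g = f≈g p
    factorIf-cong (no  _) f≈g = refl

    factorIf-yes : (d : Dec P) {x : Carrier} → P → factorIf d (λ _ → x) ≈ x
    factorIf-yes (yes _) p = refl
    factorIf-yes (no ¬p) p = contradiction p ¬p

    factorIf-no : (d : Dec P) {f : P → Carrier} → ¬ P → factorIf d f ≈ 1#
    factorIf-no (yes p) ¬p = contradiction p ¬p
    factorIf-no (no _)  ¬p = refl

    factorIf-nonNeg : (d : Dec P) {f : P → Carrier} → (∀ p → 0# ≤ f p) → 0# ≤ factorIf d f
    factorIf-nonNeg (yes p) 0≤f = 0≤f p
    factorIf-nonNeg (no  _) 0≤f = 0≤1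

  𝟙-mono : ∀ {p q} {P : Set p} {Q : Set q} (d : Dec P) (e : Dec Q) → (P → Q) → 𝟙 d ≤ 𝟙 e
  𝟙-mono (yes p) e P⇒Q = Order.reflexive (sym (𝟙-yes e (P⇒Q p)))
  𝟙-mono (no _)  e P⇒Q = 𝟙-nonNeg e

  𝟙-cong : ∀ {p q} {P : Set p} {Q : Set q} (d : Dec P) (e : Dec Q) → (P → Q) → (Q → P) → 𝟙 d ≈ 𝟙 e
  𝟙-cong d e P⇒Q Q⇒P = Order.antisym (𝟙-mono d e P⇒Q) (𝟙-mono e d Q⇒P)

  module _ {a} {A : Set a} where

    ∑-mono : ∀ (xs : List A) {f g} → (∀ x → f x ≤ g x) → ∑ xs f ≤ ∑ xs g
    ∑-mono []       f≤g = Order.refl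
    ∑-mono (x ∷ xs) f≤g = +-mono (f≤g x) (∑-mono xs f≤g)

    ∑-nonNeg : ∀ (xs : List A) {f} → (∀ x → 0# ≤ f x) → 0# ≤ ∑ xs f
    ∑-nonNeg []       0≤f = Order.refl
    ∑-nonNeg (x ∷ xs) 0≤f = +-nonNeg (0≤f x) (∑-nonNeg xs 0≤f)

    ∏-nonNeg : ∀ (xs : List A) {f} → (∀ x → 0# ≤ f x) → 0# ≤ ∏ xs f
    ∏-nonNeg []       0≤f = 0≤1
    ∏-nonNeg (x ∷ xs) 0≤f = *-nonNeg (0≤f x) (∏-nonNeg xs 0≤f)

    ∑-*ˡ : ∀ k (xs : List A) f → k * ∑ xs f ≈ ∑ xs (λ x → k * f x)
    ∑-*ˡ k []       f = zeroʳ k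
    ∑-*ˡ k (x ∷ xs) f = trans (distribˡ k _ _) (+-congˡ (∑-*ˡ k xs f))

    ∑-*ʳ : ∀ k (xs : List A) f → ∑ xs f * k ≈ ∑ xs (λ x → f x * k)
    ∑-*ʳ k xs f = trans (*-comm _ k) (trans (∑-*ˡ k xs f) (∑-cong xs λ x → *-comm k (f x)))

    term≤∑ : ∀ {xs : List A} {f y} → (∀ x → 0# ≤ f x) → y ∈ₗ xs → f y ≤ ∑ xs f
    term≤∑ {x ∷ xs} 0≤f (here ≡.refl) = x≤x+y (∑-nonNeg xs 0≤f)
    term≤∑ {x ∷ xs} 0≤f (there y∈xs)  = Order.trans (term≤∑ 0≤f y∈xs) (x≤y+x (0≤f x))

    ∑-delta : (_≟_ : DecidableEquality A) → ∀ {xs y} → Unique xs → y ∈ₗ xs →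
              ∀ (f : A → Carrier) → ∑ xs (λ x → 𝟙 (x ≟ y) * f x) ≈ f y
    ∑-delta _≟_ {x ∷ xs} {y} (x∉xs ∷ _) (here ≡.refl) f = begin-equality
      𝟙 (x ≟ x) * f x + ∑ xs (λ z → 𝟙 (z ≟ x) * f z) ≈⟨ +-cong (*-congʳ (𝟙-yes (x ≟ x) ≡.refl)) (vanish xs x∉xs) ⟩
      1# * f x + 0#                                  ≈⟨ +-identityʳ _ ⟩
      1# * f x                                       ≈⟨ *-identityˡ _ ⟩
      f x                                            ∎
      where
      vanish : ∀ zs → All (x ≢_) zs → ∑ zs (λ z → 𝟙 (z ≟ x) * f z) ≈ 0#
      vanish []       []         = refl
      vanish (z ∷ zs) (x≢z ∷ ps) = trans
        (+-cong (trans (*-congʳ (𝟙-no (z ≟ x) λ z≡x → x≢z (≡.sym z≡x))) (zeroˡ _)) (vanish zs ps))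
        (+-identityˡ 0#)
    ∑-delta _≟_ {x ∷ xs} {y} (x∉xs ∷ uniq) (there y∈xs) f = begin-equality
      𝟙 (x ≟ y) * f x + ∑ xs (λ z → 𝟙 (z ≟ y) * f z) ≈⟨ +-cong (*-congʳ (𝟙-no (x ≟ y) (distinct x∉xs y∈xs))) (∑-delta _≟_ uniq y∈xs f) ⟩
      0# * f x + f y                                 ≈⟨ +-congʳ (zeroˡ _) ⟩
      0# + f y                                       ≈⟨ +-identityˡ _ ⟩
      f y                                            ∎
      where
      distinct : ∀ {zs z} → All (x ≢_) zs → z ∈ₗ zs → x ≢ z
      distinct (x≢z ∷ _) (here ≡.refl) = x≢z
      distinct (_ ∷ ps)  (there z∈zs)  = distinct ps z∈zs

configs-unique : ∀ q m → Unique (configs q m)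
configs-unique q zero    = [] ∷ []
configs-unique q (suc m) = cartesianProductWith⁺ _∷_ ∷-injective (allFin⁺ q) (configs-unique q m)

∈-configs : ∀ {q m} (X : Config q m) → X ∈ₗ configs q m
∈-configs []      = here ≡.refl
∈-configs (a ∷ X) = ∈-cartesianProductWith⁺ _∷_ (∈-allFin a) (∈-configs X)

-- Weights of configurations relative to a pinned set.

module WeightProperties {c ℓ₁ ℓ₂} (K : ArchimedeanOrderedField c ℓ₁ ℓ₂) {n q : ℕ} (G : Graph n) (S : SpinSystem K q) where
  open ArchimedeanOrderedField K
  open OrderedFieldProperties K
  open Graph G
  open SpinSystem S
  open Gibbs K G S
  open ≤-Reasoning
  open CommutativeSemigroupProperties *-commutativeSemigroup using (interchange)

  V : List (Fin n)
  V = allFin n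

  cs : List (Config q n)
  cs = configs q n

  _≟ᶜ_ : DecidableEquality (Config q n)
  _≟ᶜ_ = ≡-dec _≟ᶠ_

  ∑-configs-delta : ∀ X (f : Config q n → Carrier) → ∑ cs (λ Y → 𝟙 (Y ≟ᶜ X) * f Y) ≈ f X
  ∑-configs-delta X f = ∑-delta _≟ᶜ_ (configs-unique q n) (∈-configs X) f

  restrict : (Λ : Subset n) → Config q n → PartialConfig q Λ
  restrict Λ X v _ = lookup X v

  module _ (Λ : Subset n) (X : Config q n) where

    vertexFactor : Fin n → Carrier
    vertexFactor v = factorIf (¬? (v ∈? Λ)) λ _ → A-V (lookup X v)

    boundaryFactor interiorFactor edgeFactor : Fin n → Fin n → Carrier
    boundaryFactor u v = factorIf (adj? u v ×-dec (¬? (u ∈? Λ) ×-dec (v ∈? Λ))) λ _ → A-E (lookup X u) (lookup X v)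
    interiorFactor u v = factorIf (¬? (u ∈? Λ) ×-dec ¬? (v ∈? Λ)) λ _ → A-E (lookup X u) (lookup X v)
    edgeFactor u v = factorIf ((u <ᶠ? v ×-dec adj? u v) ×-dec ¬? (u ∈? Λ ×-dec v ∈? Λ)) λ _ → A-E (lookup X u) (lookup X v)

    -- The pinned values are read off from X itself, so that weights for different pinned sets can
    -- be compared on the same configurations.
    freeWeight : Carrier
    freeWeight = ∏ V vertexFactor * (∏ V (λ u → ∏ V (boundaryFactor u)) * ∏ (edges G) (λ (u , v) → interiorFactor u v))

    freeWeight-nonNeg : 0# ≤ freeWeight
    freeWeight-nonNeg = *-nonNeg
      (∏-nonNeg V λ v → factorIf-nonNeg (¬? (v ∈? Λ)) λ _ → A-V-nonNeg _)
      (*-nonNeg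
        (∏-nonNeg V λ u → ∏-nonNeg V λ v →
          factorIf-nonNeg (adj? u v ×-dec (¬? (u ∈? Λ) ×-dec (v ∈? Λ))) λ _ → A-E-nonNeg _ _)
        (∏-nonNeg (edges G) λ (u , v) →
          factorIf-nonNeg (¬? (u ∈? Λ) ×-dec ¬? (v ∈? Λ)) λ _ → A-E-nonNeg _ _))

    private
      forward backward inner : Fin n → Fin n → Carrier
      forward  u v = factorIf (u <ᶠ? v) λ _ → boundaryFactor u v
      backward u v = factorIf (v <ᶠ? u) λ _ → boundaryFactor u v
      inner    u v = factorIf (u <ᶠ? v ×-dec adj? u v) λ _ → interiorFactor u v

      boundary-split : ∀ u v → boundaryFactor u v ≈ forward u v * backward u v
      boundary-split u v with <-cmp u v
      ... | tri< u<v _ u≯v = sym (trans (*-cong (factorIf-yes (u <ᶠ? v) u<v) (factorIf-no (v <ᶠ? u) u≯v)) (*-identityʳ _))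
      ... | tri> u≮v _ u>v = sym (trans (*-cong (factorIf-no (u <ᶠ? v) u≮v) (factorIf-yes (v <ᶠ? u) u>v)) (*-identityˡ _))
      ... | tri≈ u≮v u≡v u≯v = trans
        (factorIf-no (adj? u v ×-dec (¬? (u ∈? Λ) ×-dec (v ∈? Λ))) λ (uv , _) → adj-irrefl u≡v uv)
        (sym (trans (*-cong (factorIf-no (u <ᶠ? v) u≮v) (factorIf-no (v <ᶠ? u) u≯v)) (*-identityˡ _)))

      merge : ∀ u v → (forward u v * backward v u) * inner u v ≈ edgeFactor u v
      merge u v with u <ᶠ? v | adj? u v | adj? v u | u ∈? Λ | v ∈? Λ
      ... | no  _ | _      | _      | _     | _     = trans (*-identityʳ _) (*-identityʳ _)
      ... | yes _ | yes uv | no ¬vu | _     | _     = contradiction (adj-sym uv) ¬vu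
      ... | yes _ | no ¬uv | yes vu | _     | _     = contradiction (adj-sym vu) ¬uv
      ... | yes _ | no _   | no _   | _     | _     = trans (*-identityʳ _) (*-identityʳ _)
      ... | yes _ | yes _  | yes _  | yes _ | yes _ = trans (*-identityʳ _) (*-identityʳ _)
      ... | yes _ | yes _  | yes _  | no _  | yes _ = trans (*-identityʳ _) (*-identityʳ _)
      -- The boundary product lists this edge from its free endpoint v, hence with the arguments of
      -- `A-E` in the opposite order.
      ... | yes _ | yes _  | yes _  | yes _ | no _  = trans (*-identityʳ _) (trans (*-identityˡ _) (A-E-sym _ _))
      ... | yes _ | yes _  | yes _  | no _  | no _  = trans (*-congʳ (*-identityˡ _)) (*-identityˡ _)

      ∏₂-* : ∀ (f g : Fin n → Fin n → Carrier) →
             ∏ V (λ u → ∏ V (λ v → f u v * g u v)) ≈ ∏ V (λ u → ∏ V (f u)) * ∏ V (λ u → ∏ V (g u))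
      ∏₂-* f g = trans (∏-cong V λ u → ∏-* V (f u) (g u)) (∏-* V _ _)

    -- Each boundary edge is listed as an ordered pair and each interior edge
    -- once, so the boundary product is first folded onto the pairs u < v.
    freeWeight-edges : freeWeight ≈ ∏ V vertexFactor * ∏ V (λ u → ∏ V (edgeFactor u))
    freeWeight-edges = *-congˡ (begin-equality
      ∏ V (λ u → ∏ V (boundaryFactor u)) * ∏ (edges G) (λ (u , v) → interiorFactor u v)
        ≈⟨ *-cong (trans (∏-cong V λ u → ∏-cong V (boundary-split u)) (∏₂-* forward backward))
                  (trans (∏-filter (λ (u , v) → u <ᶠ? v ×-dec adj? u v) (cartesianProduct V V) {λ (u , v) → interiorFactor u v}
                            (λ {uv} p → sym (factorIf-yes (proj₁ uv <ᶠ? proj₂ uv ×-dec adj? (proj₁ uv) (proj₂ uv)) p))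
                            (λ {uv} ¬p → factorIf-no (proj₁ uv <ᶠ? proj₂ uv ×-dec adj? (proj₁ uv) (proj₂ uv)) ¬p))
                         (∏-cartesianProduct V V (λ (u , v) → inner u v))) ⟩
      (∏ V (λ u → ∏ V (forward u)) * ∏ V (λ u → ∏ V (backward u))) * ∏ V (λ u → ∏ V (inner u))
        ≈⟨ *-congʳ (*-congˡ (∏-swap V V backward)) ⟩
      (∏ V (λ u → ∏ V (forward u)) * ∏ V (λ u → ∏ V (λ v → backward v u))) * ∏ V (λ u → ∏ V (inner u))
        ≈⟨ *-congʳ (∏₂-* forward (λ u v → backward v u)) ⟨
      ∏ V (λ u → ∏ V (λ v → forward u v * backward v u)) * ∏ V (λ u → ∏ V (inner u))
        ≈⟨ ∏₂-* (λ u v → forward u v * backward v u) inner ⟨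
      ∏ V (λ u → ∏ V (λ v → (forward u v * backward v u) * inner u v))
        ≈⟨ (∏-cong V λ u → ∏-cong V (merge u)) ⟩
      ∏ V (λ u → ∏ V (edgeFactor u)) ∎)

  freeWeight-cong : ∀ {Λ} X Y → (∀ u → u ∉ Λ → lookup X u ≡ lookup Y u) →
                    (∀ u v → Adj u v → u ∉ Λ → v ∈ Λ → lookup X v ≡ lookup Y v) →
                    freeWeight Λ X ≈ freeWeight Λ Y
  freeWeight-cong {Λ} X Y off on = *-cong
    (∏-cong V λ v → factorIf-cong (¬? (v ∈? Λ)) λ v∉Λ → reflexive (≡.cong A-V (off v v∉Λ)))
    (*-cong
      (∏-cong V λ u → ∏-cong V λ v →
        factorIf-cong (adj? u v ×-dec (¬? (u ∈? Λ) ×-dec (v ∈? Λ))) λ (uv , u∉Λ , v∈Λ) →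
          reflexive (≡.cong₂ A-E (off u u∉Λ) (on u v uv u∉Λ v∈Λ)))
      (∏-cong (edges G) λ (u , v) →
        factorIf-cong (¬? (u ∈? Λ) ×-dec ¬? (v ∈? Λ)) λ (u∉Λ , v∉Λ) →
          reflexive (≡.cong₂ A-E (off u u∉Λ) (off v v∉Λ))))

  ∏-exchange : ∀ {a} {A : Set a} (xs : List A) {f g h k : A → Carrier} →
               (∀ x → f x * g x ≈ h x * k x) → ∏ xs f * ∏ xs g ≈ ∏ xs h * ∏ xs k
  ∏-exchange xs {f} {g} {h} {k} eq = trans (sym (∏-* xs f g)) (trans (∏-cong xs eq) (∏-* xs h k))

  -- Holds factor by factor. A factor with all its vertices in Λ′ takes the same value at X and at
  -- Y; any other factor is present for both Λ and Λ′, so the two sides only exchange it. The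
  -- product form avoids quotients of weights that may vanish.
  freeWeight-exchange : ∀ {Λ Λ′} X Y → Λ ⊆ Λ′ → (∀ u → u ∈ Λ′ → lookup X u ≡ lookup Y u) →
                        freeWeight Λ X * freeWeight Λ′ Y ≈ freeWeight Λ Y * freeWeight Λ′ X
  freeWeight-exchange {Λ} {Λ′} X Y Λ⊆Λ′ X≡Y = begin-equality
    freeWeight Λ X * freeWeight Λ′ Y ≈⟨ *-cong (freeWeight-edges Λ X) (freeWeight-edges Λ′ Y) ⟩
    _ ≈⟨ interchange _ _ _ _ ⟩
    _ ≈⟨ *-cong (∏-exchange V vertices) (∏-exchange V λ u → ∏-exchange V (pairs u)) ⟩
    _ ≈⟨ interchange _ _ _ _ ⟩
    _ ≈⟨ *-cong (freeWeight-edges Λ Y) (freeWeight-edges Λ′ X) ⟨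
    freeWeight Λ Y * freeWeight Λ′ X ∎
    where
    vertices : ∀ v → vertexFactor Λ X v * vertexFactor Λ′ Y v ≈ vertexFactor Λ Y v * vertexFactor Λ′ X v
    vertices v with v ∈? Λ′ | v ∈? Λ
    ... | yes v∈Λ′ | _       rewrite X≡Y v v∈Λ′ = refl
    ... | no  v∉Λ′ | yes v∈Λ = contradiction (Λ⊆Λ′ v∈Λ) v∉Λ′
    ... | no  _    | no  _   = *-comm _ _

    pairs : ∀ u v → edgeFactor Λ X u v * edgeFactor Λ′ Y u v ≈ edgeFactor Λ Y u v * edgeFactor Λ′ X u v
    pairs u v with u <ᶠ? v ×-dec adj? u v | u ∈? Λ ×-dec v ∈? Λ | u ∈? Λ′ ×-dec v ∈? Λ′
    ... | no  _ | _             | _               = refl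
    ... | yes _ | _             | yes (u∈ , v∈)   rewrite X≡Y u u∈ | X≡Y v v∈ = refl
    ... | yes _ | yes (u∈ , v∈) | no ¬both        = contradiction (Λ⊆Λ′ u∈ , Λ⊆Λ′ v∈) ¬both
    ... | yes _ | no _          | no _            = *-comm _ _

  module _ {Λ : Subset n} (σ : PartialConfig q Λ) where

    weight-extends : ∀ X → Extends X σ → weight σ X ≈ freeWeight Λ X
    weight-extends X ext = trans (*-cong (𝟙-yes (extends? X σ) ext) (*-congˡ (*-congʳ
        (∏-cong V λ u → ∏-cong V λ v →
          factorIf-cong (adj? u v ×-dec (¬? (u ∈? Λ) ×-dec (v ∈? Λ))) λ (_ , _ , v∈Λ) →
            reflexive (≡.cong (A-E (lookup X u)) (≡.sym (ext v v∈Λ)))))))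
      (*-identityˡ _)

    weight-¬extends : ∀ X → ¬ Extends X σ → weight σ X ≈ 0#
    weight-¬extends X ¬ext = trans (*-congʳ (𝟙-no (extends? X σ) ¬ext)) (zeroˡ _)

    weight-nonNeg : ∀ X → 0# ≤ weight σ X
    weight-nonNeg X with extends? X σ in eq
    ... | yes ext = ≤-respʳ (trans (sym (weight-extends X ext)) (*-congʳ (reflexive (≡.cong 𝟙 eq)))) (freeWeight-nonNeg Λ X)
    ... | no  _   = Order.reflexive (sym (zeroˡ _))

  -- Partial configurations are functions compared pointwise. This identifies the normalisers of two
  -- restrictions that agree at every pinned vertex.
  weight-cong : ∀ {Λ} {σ τ : PartialConfig q Λ} → (∀ u (u∈Λ : u ∈ Λ) → σ u u∈Λ ≡ τ u u∈Λ) →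
                ∀ X → weight σ X ≈ weight τ X
  weight-cong {σ = σ} {τ} σ≡τ X = by-cases (extends? X σ)
    where
    by-cases : Dec (Extends X σ) → weight σ X ≈ weight τ X
    by-cases (yes ext) = trans (weight-extends σ X ext)
      (sym (weight-extends τ X λ u u∈Λ → ≡.trans (ext u u∈Λ) (σ≡τ u u∈Λ)))
    by-cases (no ¬ext) = trans (weight-¬extends σ X ¬ext)
      (sym (weight-¬extends τ X λ ext → ¬ext λ u u∈Λ → ≡.trans (ext u u∈Λ) (≡.sym (σ≡τ u u∈Λ))))

-- Couplings: expectations, composition and two-stage sampling.

module CouplingProperties {c ℓ₁ ℓ₂} (K : ArchimedeanOrderedField c ℓ₁ ℓ₂) {n q : ℕ} (G : Graph n) (S : SpinSystem K q) where
  open ArchimedeanOrderedField K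
  open OrderedFieldProperties K
  open Gibbs K G S
  open WeightProperties K G S
  open ≤-Reasoning
  open CommutativeSemigroupProperties *-commutativeSemigroup using (interchange; x∙yz≈y∙xz; xy∙z≈xz∙y)

  ∑₂ : (Config q n → Config q n → Carrier) → Carrier
  ∑₂ f = ∑ cs λ X → ∑ cs (f X)

  ∑₂-cong : ∀ {f g} → (∀ X Y → f X Y ≈ g X Y) → ∑₂ f ≈ ∑₂ g
  ∑₂-cong f≈g = ∑-cong cs λ X → ∑-cong cs (f≈g X)

  ∑₂-+ : ∀ f g → ∑₂ (λ X Y → f X Y + g X Y) ≈ ∑₂ f + ∑₂ g
  ∑₂-+ f g = trans (∑-cong cs λ X → ∑-+ cs (f X) (g X)) (∑-+ cs _ _)

  ∑₂-*ˡ : ∀ k f → k * ∑₂ f ≈ ∑₂ (λ X Y → k * f X Y)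
  ∑₂-*ˡ k f = trans (∑-*ˡ k cs _) (∑-cong cs λ X → ∑-*ˡ k cs (f X))

  ∑₂-*ʳ : ∀ k f → ∑₂ f * k ≈ ∑₂ (λ X Y → f X Y * k)
  ∑₂-*ʳ k f = trans (∑-*ʳ k cs _) (∑-cong cs λ X → ∑-*ʳ k cs (f X))

  ∑-∑₂-swap : ∀ {a} {A : Set a} xs (f : A → Config q n → Config q n → Carrier) →
              ∑ xs (λ x → ∑₂ (f x)) ≈ ∑₂ (λ X Y → ∑ xs (λ x → f x X Y))
  ∑-∑₂-swap xs f = trans (∑-swap xs cs _) (∑-cong cs λ X → ∑-swap xs cs (λ x → f x X))

  module _ {μ₁ μ₂ : Config q n → Carrier} (𝒞 : Coupling μ₁ μ₂) where
    open Coupling 𝒞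

    joint≤₁ : ∀ X Y → joint X Y ≤ μ₁ X
    joint≤₁ X Y = ≤-respʳ (marginal-₁ X) (term≤∑ (nonNeg X) (∈-configs Y))

    joint≤₂ : ∀ X Y → joint X Y ≤ μ₂ Y
    joint≤₂ X Y = ≤-respʳ (marginal-₂ Y) (term≤∑ {f = λ X → joint X Y} (λ X → nonNeg X Y) (∈-configs X))

    𝔼-mono : ∀ {f g} → (∀ X Y → f X Y ≤ g X Y) → 𝔼 f ≤ 𝔼 g
    𝔼-mono f≤g = ∑-mono cs λ X → ∑-mono cs λ Y → *-monoˡ _ (nonNeg X Y) (f≤g X Y)

    𝔼-nonNeg : ∀ {f} → (∀ X Y → 0# ≤ f X Y) → 0# ≤ 𝔼 f
    𝔼-nonNeg 0≤f = ∑-nonNeg cs λ X → ∑-nonNeg cs λ Y → *-nonNeg (nonNeg X Y) (0≤f X Y)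

    𝔼-+ : ∀ f g → 𝔼 (λ X Y → f X Y + g X Y) ≈ 𝔼 f + 𝔼 g
    𝔼-+ f g = trans (∑₂-cong λ X Y → distribˡ _ _ _) (∑₂-+ _ _)

    𝔼-*ˡ : ∀ k f → 𝔼 (λ X Y → k * f X Y) ≈ k * 𝔼 f
    𝔼-*ˡ k f = trans (∑₂-cong λ X Y → x∙yz≈y∙xz _ _ _) (sym (∑₂-*ˡ k _))

    𝔼-∑ : ∀ {a} {A : Set a} xs (f : A → Config q n → Config q n → Carrier) →
          𝔼 (λ X Y → ∑ xs (λ x → f x X Y)) ≈ ∑ xs (λ x → 𝔼 (f x))
    𝔼-∑ xs f = trans (∑₂-cong λ X Y → ∑-*ˡ _ xs _) (sym (∑-∑₂-swap xs _))

  module _ {μ₁ μ₂ μ₃ : Config q n → Carrier} (P : Coupling μ₁ μ₂) (Q : Coupling μ₂ μ₃) where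
    private
      module P = Coupling P
      module Q = Coupling Q

      -- The law of a triple in which X and Z are conditionally independent given Y. Where `μ₂ Y` is
      -- zero, both joint laws vanish at Y because they are bounded by `μ₂ Y`.
      T : (X Y Z : Config q n) → Carrier
      T X Y Z = P.joint X Y * inv (μ₂ Y) * Q.joint Y Z

      0≤μ₂ : ∀ Y → 0# ≤ μ₂ Y
      0≤μ₂ Y = ≤-respʳ (P.marginal-₂ Y) (∑-nonNeg cs λ X → P.nonNeg X Y)

      T-nonNeg : ∀ X Y Z → 0# ≤ T X Y Z
      T-nonNeg X Y Z = *-nonNeg (*-nonNeg (P.nonNeg X Y) (inv-nonNeg (0≤μ₂ Y))) (Q.nonNeg Y Z)

      ∑₃T : ∀ X Y → ∑ cs (T X Y) ≈ P.joint X Y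
      ∑₃T X Y = begin-equality
        ∑ cs (T X Y)                                          ≈⟨ ∑-*ˡ _ cs (Q.joint Y) ⟨
        P.joint X Y * inv (μ₂ Y) * ∑ cs (Q.joint Y)           ≈⟨ *-congˡ (Q.marginal-₁ Y) ⟩
        P.joint X Y * inv (μ₂ Y) * μ₂ Y                       ≈⟨ inv-absorb (P.nonNeg X Y) (joint≤₂ P X Y) ⟩
        P.joint X Y                                           ∎

      ∑₁T : ∀ Y Z → ∑ cs (λ X → T X Y Z) ≈ Q.joint Y Z
      ∑₁T Y Z = begin-equality
        ∑ cs (λ X → T X Y Z)                                  ≈⟨ ∑-*ʳ _ cs _ ⟨
        ∑ cs (λ X → P.joint X Y * inv (μ₂ Y)) * Q.joint Y Z   ≈⟨ *-congʳ (∑-*ʳ _ cs _) ⟨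
        ∑ cs (λ X → P.joint X Y) * inv (μ₂ Y) * Q.joint Y Z   ≈⟨ *-congʳ (*-congʳ (P.marginal-₂ Y)) ⟩
        μ₂ Y * inv (μ₂ Y) * Q.joint Y Z                       ≈⟨ *-comm _ _ ⟩
        Q.joint Y Z * (μ₂ Y * inv (μ₂ Y))                     ≈⟨ *-congˡ (*-comm _ _) ⟩
        Q.joint Y Z * (inv (μ₂ Y) * μ₂ Y)                     ≈⟨ *-assoc _ _ _ ⟨
        Q.joint Y Z * inv (μ₂ Y) * μ₂ Y                       ≈⟨ inv-absorb (Q.nonNeg Y Z) (joint≤₁ Q Y Z) ⟩
        Q.joint Y Z                                           ∎

    glue : Coupling μ₁ μ₃
    glue = record
      { joint      = λ X Z → ∑ cs λ Y → T X Y Z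
      ; nonNeg     = λ X Z → ∑-nonNeg cs λ Y → T-nonNeg X Y Z
      ; marginal-₁ = λ X → trans (∑-swap cs cs _) (trans (∑-cong cs (∑₃T X)) (P.marginal-₁ X))
      ; marginal-₂ = λ Z → trans (∑-swap cs cs _) (trans (∑-cong cs λ Y → ∑₁T Y Z) (Q.marginal-₂ Z))
      }

    𝔼-glue : ∀ {f g h} → (∀ X Y Z → f X Z ≤ g X Y + h Y Z) → Coupling.𝔼 glue f ≤ P.𝔼 g + Q.𝔼 h
    𝔼-glue {f} {g} {h} tri = begin
      ∑₂ (λ X Z → ∑ cs (λ Y → T X Y Z) * f X Z)
        ≈⟨ ∑₂-cong (λ X Z → ∑-*ʳ _ cs _) ⟩
      ∑₂ (λ X Z → ∑ cs (λ Y → T X Y Z * f X Z))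
        ≤⟨ (∑-mono cs λ X → ∑-mono cs λ Z → ∑-mono cs λ Y → *-monoˡ _ (T-nonNeg X Y Z) (tri X Y Z)) ⟩
      ∑₂ (λ X Z → ∑ cs (λ Y → T X Y Z * (g X Y + h Y Z)))
        ≈⟨ ∑₂-cong (λ X Z → trans (∑-cong cs λ Y → distribˡ _ _ _) (∑-+ cs _ _)) ⟩
      ∑₂ (λ X Z → ∑ cs (λ Y → T X Y Z * g X Y) + ∑ cs (λ Y → T X Y Z * h Y Z))
        ≈⟨ ∑₂-+ _ _ ⟩
      ∑₂ (λ X Z → ∑ cs (λ Y → T X Y Z * g X Y)) + ∑₂ (λ X Z → ∑ cs (λ Y → T X Y Z * h Y Z))
        ≈⟨ +-cong (∑-cong cs λ X → ∑-swap cs cs _) (sym (∑-∑₂-swap cs _)) ⟩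
      ∑₂ (λ X Y → ∑ cs (λ Z → T X Y Z * g X Y)) + ∑ cs (λ Y → ∑₂ (λ X Z → T X Y Z * h Y Z))
        ≈⟨ +-cong (∑₂-cong λ X Y → trans (sym (∑-*ʳ _ cs _)) (*-congʳ (∑₃T X Y)))
                  (∑-cong cs λ Y → trans (∑-swap cs cs _)
                                         (∑-cong cs λ Z → trans (sym (∑-*ʳ _ cs _)) (*-congʳ (∑₁T Y Z)))) ⟩
      P.𝔼 g + Q.𝔼 h ∎

  module _ {μ₁ μ₂ : Config q n → Carrier} {ρ₁ ρ₂ : Config q n → Config q n → Carrier}
           (stationary₁ : ∀ X′ → ∑ cs (λ X → μ₁ X * ρ₁ X X′) ≈ μ₁ X′)
           (stationary₂ : ∀ Y′ → ∑ cs (λ Y → μ₂ Y * ρ₂ Y Y′) ≈ μ₂ Y′)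
           (P : Coupling μ₁ μ₂) (Q : ∀ X Y → Coupling (ρ₁ X) (ρ₂ Y)) where
    private
      module P = Coupling P
      module Q X Y = Coupling (Q X Y)

    -- Draw (X, Y) from `P`, then (X′, Y′) from `Q X Y`. The second draw couples one row of each
    -- kernel, so stationarity gives its marginals back as `μ₁` and `μ₂`.
    resample : Coupling μ₁ μ₂
    resample = record
      { joint      = λ X′ Y′ → ∑₂ λ X Y → P.joint X Y * Q.joint X Y X′ Y′
      ; nonNeg     = λ X′ Y′ → ∑-nonNeg cs λ X → ∑-nonNeg cs λ Y → *-nonNeg (P.nonNeg X Y) (Q.nonNeg X Y X′ Y′)
      ; marginal-₁ = λ X′ → begin-equality
          ∑ cs (λ Y′ → ∑₂ λ X Y → P.joint X Y * Q.joint X Y X′ Y′)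
            ≈⟨ ∑-∑₂-swap cs _ ⟩
          ∑₂ (λ X Y → ∑ cs λ Y′ → P.joint X Y * Q.joint X Y X′ Y′)
            ≈⟨ ∑₂-cong (λ X Y → trans (sym (∑-*ˡ _ cs _)) (*-congˡ (Q.marginal-₁ X Y X′))) ⟩
          ∑₂ (λ X Y → P.joint X Y * ρ₁ X X′)
            ≈⟨ (∑-cong cs λ X → trans (sym (∑-*ʳ _ cs _)) (*-congʳ (P.marginal-₁ X))) ⟩
          ∑ cs (λ X → μ₁ X * ρ₁ X X′)
            ≈⟨ stationary₁ X′ ⟩
          μ₁ X′ ∎
      ; marginal-₂ = λ Y′ → begin-equality
          ∑ cs (λ X′ → ∑₂ λ X Y → P.joint X Y * Q.joint X Y X′ Y′)
            ≈⟨ ∑-∑₂-swap cs _ ⟩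
          ∑₂ (λ X Y → ∑ cs λ X′ → P.joint X Y * Q.joint X Y X′ Y′)
            ≈⟨ ∑₂-cong (λ X Y → trans (sym (∑-*ˡ _ cs _)) (*-congˡ (Q.marginal-₂ X Y Y′))) ⟩
          ∑₂ (λ X Y → P.joint X Y * ρ₂ Y Y′)
            ≈⟨ ∑-swap cs cs _ ⟩
          ∑₂ (λ Y X → P.joint X Y * ρ₂ Y Y′)
            ≈⟨ (∑-cong cs λ Y → trans (sym (∑-*ʳ _ cs _)) (*-congʳ (P.marginal-₂ Y))) ⟩
          ∑ cs (λ Y → μ₂ Y * ρ₂ Y Y′)
            ≈⟨ stationary₂ Y′ ⟩
          μ₂ Y′ ∎
      }

    𝔼-resample : ∀ f → Coupling.𝔼 resample f ≈ P.𝔼 (λ X Y → Q.𝔼 X Y f)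
    𝔼-resample f = begin-equality
      ∑₂ (λ X′ Y′ → ∑₂ (λ X Y → P.joint X Y * Q.joint X Y X′ Y′) * f X′ Y′)
        ≈⟨ ∑₂-cong (λ X′ Y′ → ∑₂-*ʳ _ _) ⟩
      ∑₂ (λ X′ Y′ → ∑₂ (λ X Y → P.joint X Y * Q.joint X Y X′ Y′ * f X′ Y′))
        ≈⟨ (∑-cong cs λ X′ → ∑-∑₂-swap cs _) ⟩
      ∑ cs (λ X′ → ∑₂ (λ X Y → ∑ cs λ Y′ → P.joint X Y * Q.joint X Y X′ Y′ * f X′ Y′))
        ≈⟨ ∑-∑₂-swap cs _ ⟩
      ∑₂ (λ X Y → ∑₂ λ X′ Y′ → P.joint X Y * Q.joint X Y X′ Y′ * f X′ Y′)
        ≈⟨ ∑₂-cong (λ X Y → trans (∑₂-cong λ X′ Y′ → *-assoc _ _ _) (sym (∑₂-*ˡ _ _))) ⟩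
      ∑₂ (λ X Y → P.joint X Y * ∑₂ λ X′ Y′ → Q.joint X Y X′ Y′ * f X′ Y′) ∎

  -- Overwriting the pinned part of a configuration.

  module _ {Λ : Subset n} where

    overwriteAt : PartialConfig q Λ → Config q n → Fin n → Fin q
    overwriteAt τ X u with u ∈? Λ
    ... | yes u∈Λ = τ u u∈Λ
    ... | no  _   = lookup X u

    overwrite : PartialConfig q Λ → Config q n → Config q n
    overwrite τ X = tabulate (overwriteAt τ X)

    overwriteAt-∈ : ∀ τ X {u} (u∈Λ : u ∈ Λ) → overwriteAt τ X u ≡ τ u u∈Λ
    overwriteAt-∈ τ X {u} u∈Λ with u ∈? Λ
    ... | yes _   = ≡.refl
    ... | no  u∉Λ = contradiction u∈Λ u∉Λ

    overwriteAt-∉ : ∀ τ X {u} → u ∉ Λ → overwriteAt τ X u ≡ lookup X u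
    overwriteAt-∉ τ X {u} u∉Λ with u ∈? Λ
    ... | yes u∈Λ = contradiction u∈Λ u∉Λ
    ... | no  _   = ≡.refl

    overwrite-off : ∀ {τ X Y} → Y ≡ overwrite τ X → ∀ u → u ∉ Λ → lookup X u ≡ lookup Y u
    overwrite-off {τ} {X} ≡.refl u u∉Λ =
      ≡.sym (≡.trans (lookup∘tabulate (overwriteAt τ X) u) (overwriteAt-∉ τ X u∉Λ))

    overwrite-extends : ∀ {τ X Y} → Y ≡ overwrite τ X → Extends Y τ
    overwrite-extends {τ} {X} ≡.refl u u∈Λ =
      ≡.trans (lookup∘tabulate (overwriteAt τ X) u) (overwriteAt-∈ τ X u∈Λ)

    -- Overwriting forgets only the values on Λ, which σ restores. It is thus a bijection from the
    -- extensions of σ to those of τ, the basis for comparing their normalisers.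
    overwrite-inverse : ∀ {σ τ X Y} → Extends X σ → Y ≡ overwrite τ X → X ≡ overwrite σ Y
    overwrite-inverse {σ} {τ} {X} {Y} ext Y≡ = ≡.trans (≡.sym (tabulate∘lookup X)) (tabulate-cong agree)
      where
      agree : ∀ u → lookup X u ≡ overwriteAt σ Y u
      agree u with u ∈? Λ
      ... | yes u∈Λ = ext u u∈Λ
      ... | no  u∉Λ = overwrite-off Y≡ u u∉Λ

  module _ (wellDefined : WellDefined) where

    module _ {Λ : Subset n} (σ : PartialConfig q Λ) where

      normaliser≉0 : ¬ (normaliser σ ≈ 0#)
      normaliser≉0 Z≈0 = proj₂ (wellDefined Λ σ) (sym Z≈0)

      μ-nonNeg : ∀ X → 0# ≤ μ σ X
      μ-nonNeg X = *-nonNeg (weight-nonNeg σ X) (⁻¹-nonNeg (proj₁ (wellDefined Λ σ)) normaliser≉0)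

      ∑-μ : ∑ cs (μ σ) ≈ 1#
      ∑-μ = trans (sym (∑-*ʳ _ cs (weight σ))) (⁻¹-inverse _ normaliser≉0)

      μ-¬extends : ∀ X → ¬ Extends X σ → μ σ X ≈ 0#
      μ-¬extends X ¬ext = trans (*-congʳ (weight-¬extends σ X ¬ext)) (zeroˡ _)

    -- Detailed balance for redrawing everything outside a larger pinned set.

    module _ {Λ Λ′ : Subset n} (Λ⊆Λ′ : Λ ⊆ Λ′) (σ : PartialConfig q Λ) where

      private
        AgreeOnΛ′ : Config q n → Config q n → Set
        AgreeOnΛ′ X Y = ∀ u → u ∈ Λ′ → lookup X u ≡ lookup Y u

        extends-transport : ∀ X Y → AgreeOnΛ′ X Y → Extends X σ → Extends Y σ
        extends-transport X Y X≡Y ext u u∈Λ = ≡.trans (≡.sym (X≡Y u (Λ⊆Λ′ u∈Λ))) (ext u u∈Λ)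

        agree-sym : ∀ X Y → AgreeOnΛ′ X Y → AgreeOnΛ′ Y X
        agree-sym X Y X≡Y u u∈Λ′ = ≡.sym (X≡Y u u∈Λ′)

        weight-reversible : ∀ X Y → AgreeOnΛ′ X Y → Dec (Extends X σ) →
          weight σ X * weight (restrict Λ′ X) Y ≈ weight σ Y * weight (restrict Λ′ Y) X
        weight-reversible X Y X≡Y (yes ext) = begin-equality
          weight σ X * weight (restrict Λ′ X) Y ≈⟨ *-cong (weight-extends σ X ext) (weight-extends (restrict Λ′ X) Y (agree-sym X Y X≡Y)) ⟩
          freeWeight Λ X * freeWeight Λ′ Y      ≈⟨ freeWeight-exchange X Y Λ⊆Λ′ X≡Y ⟩
          freeWeight Λ Y * freeWeight Λ′ X      ≈⟨ *-cong (weight-extends σ Y (extends-transport X Y X≡Y ext)) (weight-extends (restrict Λ′ Y) X X≡Y) ⟨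
          weight σ Y * weight (restrict Λ′ Y) X ∎
        weight-reversible X Y X≡Y (no ¬ext) = trans
          (trans (*-congʳ (weight-¬extends σ X ¬ext)) (zeroˡ _))
          (sym (trans (*-congʳ (weight-¬extends σ Y λ ext → ¬ext (extends-transport Y X (agree-sym X Y X≡Y) ext))) (zeroˡ _)))

      -- Both sides vanish unless X and Y agree on Λ′. If they do, the two restrictions have the
      -- same normaliser and the weights balance by `freeWeight-exchange`.
      μ-reversible : ∀ X Y → μ σ X * μ (restrict Λ′ X) Y ≈ μ σ Y * μ (restrict Λ′ Y) X
      μ-reversible X Y = by-cases (extends? X (restrict Λ′ Y))
        where
        by-cases : Dec (AgreeOnΛ′ X Y) → μ σ X * μ (restrict Λ′ X) Y ≈ μ σ Y * μ (restrict Λ′ Y) X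
        by-cases (yes X≡Y) = begin-equality
          μ σ X * μ (restrict Λ′ X) Y
            ≈⟨ interchange _ _ _ _ ⟩
          (weight σ X * weight (restrict Λ′ X) Y) * (normaliser σ ⁻¹ * normaliser (restrict Λ′ X) ⁻¹)
            ≈⟨ *-cong (weight-reversible X Y X≡Y (extends? X σ)) (*-congˡ (⁻¹-cong (∑-cong cs (weight-cong X≡Y)))) ⟩
          (weight σ Y * weight (restrict Λ′ Y) X) * (normaliser σ ⁻¹ * normaliser (restrict Λ′ Y) ⁻¹)
            ≈⟨ interchange _ _ _ _ ⟩
          μ σ Y * μ (restrict Λ′ Y) X ∎
        by-cases (no X≢Y) = trans
          (trans (*-congˡ (μ-¬extends (restrict Λ′ X) Y λ Y≡X → X≢Y (agree-sym Y X Y≡X))) (zeroʳ _))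
          (sym (trans (*-congˡ (μ-¬extends (restrict Λ′ Y) X X≢Y)) (zeroʳ _)))

      μ-stationary : ∀ Y → ∑ cs (λ X → μ σ X * μ (restrict Λ′ X) Y) ≈ μ σ Y
      μ-stationary Y = begin-equality
        ∑ cs (λ X → μ σ X * μ (restrict Λ′ X) Y) ≈⟨ (∑-cong cs λ X → μ-reversible X Y) ⟩
        ∑ cs (λ X → μ σ Y * μ (restrict Λ′ Y) X) ≈⟨ ∑-*ˡ _ cs _ ⟨
        μ σ Y * ∑ cs (μ (restrict Λ′ Y))         ≈⟨ *-congˡ (∑-μ (restrict Λ′ Y)) ⟩
        μ σ Y * 1#                               ≈⟨ *-identityʳ _ ⟩
        μ σ Y                                    ∎

    -- If all vertices where σ and τ differ have their whole neighbourhood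
    -- pinned, then μ σ and μ τ agree off Λ, so one sample can serve both.
    module _ {Λ : Subset n} (σ τ : PartialConfig q Λ)
             (isolated : ∀ {u w} (w∈Λ : w ∈ Λ) → σ w w∈Λ ≢ τ w w∈Λ → Graph.Adj G u w → u ∈ Λ) where
      private
        -- The premise is vacuous off Λ, so agreement is demanded at all free vertices as well as at
        -- the pinned ones where σ and τ coincide.
        AgreeWhereσ≡τ : Config q n → Config q n → Set
        AgreeWhereσ≡τ X Y = ∀ u → (∀ (u∈Λ : u ∈ Λ) → σ u u∈Λ ≡ τ u u∈Λ) → lookup X u ≡ lookup Y u

        agree : ∀ {X Y} → Extends X σ → Y ≡ overwrite τ X → AgreeWhereσ≡τ X Y
        agree ext Y≡ u σ≡τ with u ∈? Λ
        ... | yes u∈Λ = ≡.trans (ext u u∈Λ) (≡.trans (σ≡τ u∈Λ) (≡.sym (overwrite-extends Y≡ u u∈Λ)))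
        ... | no  u∉Λ = overwrite-off Y≡ u u∉Λ

        -- A pinned value enters the weight only through an edge to a free vertex, and `isolated`
        -- excludes such edges at the vertices where σ and τ differ.
        freeWeight-agree : ∀ X Y → AgreeWhereσ≡τ X Y → freeWeight Λ X ≈ freeWeight Λ Y
        freeWeight-agree X Y X≡Y = freeWeight-cong X Y
          (λ u u∉Λ → X≡Y u λ u∈Λ → contradiction u∈Λ u∉Λ)
          (λ u v uv u∉Λ v∈Λ → X≡Y v λ v∈Λ′ →
            decidable-stable (σ v v∈Λ′ ≟ᶠ τ v v∈Λ′) λ σ≢τ → u∉Λ (isolated v∈Λ′ σ≢τ uv))

      private
        -- Both sides live on the pairs where X extends σ and Y is its overwriting by τ, a relation
        -- symmetric under exchanging (σ, X) with (τ, Y). Summed over both arguments, the identity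
        -- equates the normalisers.
        swap-cases : ∀ X Y → Dec (Extends X σ × Y ≡ overwrite τ X) →
          weight σ X * 𝟙 (Y ≟ᶜ overwrite τ X) ≈ weight τ Y * 𝟙 (X ≟ᶜ overwrite σ Y)
        swap-cases X Y (yes (ext , Y≡)) = *-cong
          (trans (weight-extends σ X ext)
            (trans (freeWeight-agree X Y (agree ext Y≡)) (sym (weight-extends τ Y (overwrite-extends Y≡)))))
          (trans (𝟙-yes (Y ≟ᶜ overwrite τ X) Y≡)
            (sym (𝟙-yes (X ≟ᶜ overwrite σ Y) (overwrite-inverse ext Y≡))))
        swap-cases X Y (no ¬linked) = trans
          (unlinked σ X (Y ≟ᶜ overwrite τ X) ¬linked)
          (sym (unlinked τ Y (X ≟ᶜ overwrite σ Y) λ (ext , X≡) →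
            ¬linked (overwrite-extends X≡ , overwrite-inverse ext X≡)))
          where
          unlinked : ∀ (ρ : PartialConfig q Λ) Z {P : Set} (d : Dec P) → ¬ (Extends Z ρ × P) → weight ρ Z * 𝟙 d ≈ 0#
          unlinked ρ Z (no _)  _  = zeroʳ _
          unlinked ρ Z (yes p) ¬× = trans (*-congʳ (weight-¬extends ρ Z λ ext → ¬× (ext , p))) (zeroˡ _)

      weight-overwrite : ∀ X Y → weight σ X * 𝟙 (Y ≟ᶜ overwrite τ X) ≈ weight τ Y * 𝟙 (X ≟ᶜ overwrite σ Y)
      weight-overwrite X Y = swap-cases X Y (extends? X σ ×-dec Y ≟ᶜ overwrite τ X)

      private
        ∑-point : ∀ k Z → ∑ cs (λ Y → k * 𝟙 (Y ≟ᶜ Z)) ≈ k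
        ∑-point k Z = trans (∑-cong cs λ Y → *-comm k _) (∑-configs-delta Z λ _ → k)

      normaliser-overwrite : normaliser σ ≈ normaliser τ
      normaliser-overwrite = begin-equality
        ∑ cs (weight σ)
          ≈⟨ (∑-cong cs λ X → ∑-point (weight σ X) (overwrite τ X)) ⟨
        ∑₂ (λ X Y → weight σ X * 𝟙 (Y ≟ᶜ overwrite τ X))
          ≈⟨ ∑₂-cong weight-overwrite ⟩
        ∑₂ (λ X Y → weight τ Y * 𝟙 (X ≟ᶜ overwrite σ Y))
          ≈⟨ ∑-swap cs cs _ ⟩
        ∑₂ (λ Y X → weight τ Y * 𝟙 (X ≟ᶜ overwrite σ Y))
          ≈⟨ (∑-cong cs λ Y → ∑-point (weight τ Y) (overwrite σ Y)) ⟩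
        ∑ cs (weight τ) ∎

      private
        μ-overwrite : ∀ X Y → μ σ X * 𝟙 (Y ≟ᶜ overwrite τ X) ≈ μ τ Y * 𝟙 (X ≟ᶜ overwrite σ Y)
        μ-overwrite X Y = begin-equality
          μ σ X * 𝟙 (Y ≟ᶜ overwrite τ X)                             ≈⟨ xy∙z≈xz∙y _ _ _ ⟩
          (weight σ X * 𝟙 (Y ≟ᶜ overwrite τ X)) * normaliser σ ⁻¹    ≈⟨ *-cong (weight-overwrite X Y) (⁻¹-cong normaliser-overwrite) ⟩
          (weight τ Y * 𝟙 (X ≟ᶜ overwrite σ Y)) * normaliser τ ⁻¹    ≈⟨ xy∙z≈xz∙y _ _ _ ⟩
          μ τ Y * 𝟙 (X ≟ᶜ overwrite σ Y)                             ∎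

      isolatedCoupling : Coupling (μ σ) (μ τ)
      isolatedCoupling = record
        { joint      = λ X Y → μ σ X * 𝟙 (Y ≟ᶜ overwrite τ X)
        ; nonNeg     = λ X Y → *-nonNeg (μ-nonNeg σ X) (𝟙-nonNeg (Y ≟ᶜ overwrite τ X))
        ; marginal-₁ = λ X → ∑-point (μ σ X) (overwrite τ X)
        ; marginal-₂ = λ Y → trans (∑-cong cs λ X → μ-overwrite X Y) (∑-point (μ τ Y) (overwrite σ Y))
        }

      𝔼-isolatedCoupling : ∀ {f} →
        (∀ X Y → (∀ u → (∀ (u∈Λ : u ∈ Λ) → σ u u∈Λ ≡ τ u u∈Λ) → lookup X u ≡ lookup Y u) → f X Y ≈ 0#) →
        Coupling.𝔼 isolatedCoupling f ≈ 0#
      𝔼-isolatedCoupling {f} f≈0 = ∑-zero cs λ X → ∑-zero cs λ Y → vanish X Y (extends? X σ) (Y ≟ᶜ overwrite τ X)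
        where
        vanish : ∀ X Y → Dec (Extends X σ) → (d : Dec (Y ≡ overwrite τ X)) → μ σ X * 𝟙 d * f X Y ≈ 0#
        vanish X Y (yes ext) (yes Y≡) = trans (*-congˡ (f≈0 X Y (agree ext Y≡))) (zeroʳ _)
        vanish X Y (no ¬ext) _        = trans (*-congʳ (trans (*-congʳ (μ-¬extends σ X ¬ext)) (zeroˡ _))) (zeroˡ _)
        vanish X Y (yes _)   (no _)   = trans (*-congʳ (zeroʳ _)) (zeroˡ _)

-- Vertex sets given by predicates, and distance through walks.

module _ {n p} {P : Pred (Fin n) p} (P? : Decidable₁ P) where

  select : Subset n
  select = tabulate λ u → does (P? u)

  ∈-select⁺ : ∀ {u} → P u → u ∈ select
  ∈-select⁺ {u} Pu = lookup⇒[]= u select (≡.trans (lookup∘tabulate _ u) (dec-true (P? u) Pu))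

  ∈-select⁻ : ∀ {u} → u ∈ select → P u
  ∈-select⁻ {u} u∈ with P? u | ≡.trans (≡.sym (lookup∘tabulate (λ u → does (P? u)) u)) ([]=⇒lookup u∈)
  ... | yes Pu | _ = Pu
  ... | no  _  | ()

module _ {n : ℕ} (G : Graph n) where
  open Graph G

  walk-++ : ∀ {j k u v w} → Walk G j u v → Walk G k v w → Walk G (j +ℕ k) u w
  walk-++ here       q = q
  walk-++ (step a p) q = step a (walk-++ p q)

  -- dist u v ≥ R, where vertices in other components are infinitely far.
  FarFrom : ℕ → Fin n → Fin n → Set
  FarFrom R v u = ∀ {k} → k <ℕ R → ¬ Walk G k u v

  farFrom? : ∀ R v u → Dec (FarFrom R v u)
  farFrom? R v u = allUpTo? (λ k → ¬? (walk? G k u v)) R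

  farFrom-antitone : ∀ {r R v u} → r ≤ℕ R → FarFrom R v u → FarFrom r v u
  farFrom-antitone r≤R far k<r = far (ℕ.≤-trans k<r r≤R)

  farFrom-suc : ∀ {R v u} → FarFrom R v u → ¬ Walk G R u v → FarFrom (suc R) v u
  farFrom-suc far ¬walk k<1+R with m<1+n⇒m<n∨m≡n k<1+R
  ... | inj₁ k<R    = far k<R
  ... | inj₂ ≡.refl = ¬walk

  farFrom-adjacent : ∀ {R v u w} → Adj u w → FarFrom (suc R) v u → FarFrom R v w
  farFrom-adjacent uw far k<R walk = far (s≤s k<R) (step uw walk)

  -- The triangle inequality: a walk from u to w shorter than `R ∸ r`, continued to v, would be
  -- shorter than R.
  farFrom-shift : ∀ {r R v w u} → r ≤ℕ R → Walk G r w v → FarFrom R v u → FarFrom (R ∸ r) w u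
  farFrom-shift {r} r≤R w⇝v far k<R∸r u⇝w =
    far (≡.subst (_ ≤ℕ_) (m∸n+n≡m r≤R) (ℕ.+-monoˡ-≤ r k<R∸r)) (walk-++ u⇝w w⇝v)

  farFrom-self : ∀ {R v} → ¬ FarFrom (suc R) v v
  farFrom-self far = far (s≤s z≤n) here

-- Counting disagreements far from a vertex.

module DisagreementDecay {c ℓ₁ ℓ₂} (K : ArchimedeanOrderedField c ℓ₁ ℓ₂) {n q : ℕ} (G : Graph n) (S : SpinSystem K q) where
  open ArchimedeanOrderedField K
  open OrderedFieldProperties K
  open Graph G
  open Gibbs K G S
  open WeightProperties K G S
  open CouplingProperties K G S
  open ≤-Reasoning
  open AbelianGroupProperties +-abelianGroup using () renaming (⁻¹-anti-homo‿- to -‿anti-homo)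
  open CommutativeSemigroupProperties *-commutativeSemigroup using (x∙yz≈y∙xz)

  neq : Fin n → Config q n → Config q n → Carrier
  neq u X Y = 𝟙 (¬? (lookup X u ≟ᶠ lookup Y u))

  neq-nonNeg : ∀ u X Y → 0# ≤ neq u X Y
  neq-nonNeg u X Y = 𝟙-nonNeg (¬? (lookup X u ≟ᶠ lookup Y u))

  neq-≡ : ∀ u X Y → lookup X u ≡ lookup Y u → neq u X Y ≈ 0#
  neq-≡ u X Y eq = 𝟙-no (¬? (lookup X u ≟ᶠ lookup Y u)) λ ne → ne eq

  neq-≢ : ∀ u X Y → lookup X u ≢ lookup Y u → neq u X Y ≈ 1#
  neq-≢ u X Y ne = 𝟙-yes (¬? (lookup X u ≟ᶠ lookup Y u)) ne

  neq-triangle : ∀ u X Y Z → neq u X Z ≤ neq u X Y + neq u Y Z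
  neq-triangle u X Y Z with lookup X u ≟ᶠ lookup Y u
  ... | yes X≡Y rewrite X≡Y = Order.reflexive (sym (+-identityˡ _))
  ... | no  _   = Order.trans (𝟙-≤1 (¬? (lookup X u ≟ᶠ lookup Z u))) (x≤x+y (neq-nonNeg u Y Z))

  -- Restricting attention to a sphere would not survive the recursion: the
  -- sphere of radius R around v is only known to lie outside the ball of
  -- radius R - r around a vertex at distance r from v.
  far : ℕ → Fin n → Config q n → Config q n → Carrier
  far R v X Y = ∑ V λ u → 𝟙 (farFrom? G R v u) * neq u X Y

  far-triangle : ∀ R v X Y Z → far R v X Z ≤ far R v X Y + far R v Y Z
  far-triangle R v X Y Z = begin
    far R v X Z ≤⟨ (∑-mono V λ u → *-monoˡ _ (𝟙-nonNeg (farFrom? G R v u)) (neq-triangle u X Y Z)) ⟩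
    _           ≈⟨ (∑-cong V λ u → distribˡ _ _ _) ⟩
    _           ≈⟨ ∑-+ V _ _ ⟩
    far R v X Y + far R v Y Z ∎

  far≤hamming : ∀ R v X Y → far R v X Y ≤ hamming X Y
  far≤hamming R v X Y = ∑-mono V λ u →
    ≤-respʳ (*-identityˡ _) (*-monoʳ _ (neq-nonNeg u X Y) (𝟙-≤1 (farFrom? G R v u)))

  far-vanish : ∀ R v X Y → (∀ u → FarFrom G R v u → lookup X u ≡ lookup Y u) → far R v X Y ≈ 0#
  far-vanish R v X Y agree = ∑-zero V λ u → by-cases u (farFrom? G R v u)
    where
    by-cases : ∀ u → (d : Dec (FarFrom G R v u)) → 𝟙 d * neq u X Y ≈ 0#
    by-cases u (yes isFar) = trans (*-congˡ (neq-≡ u X Y (agree u isFar))) (zeroʳ _)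
    by-cases u (no _)      = zeroˡ _

  far-mono : ∀ {R R′ v w} → (∀ {u} → FarFrom G R v u → FarFrom G R′ w u) → ∀ X Y → far R v X Y ≤ far R′ w X Y
  far-mono {R} {R′} {v} {w} imp X Y = ∑-mono V λ u →
    *-monoʳ _ (neq-nonNeg u X Y) (𝟙-mono (farFrom? G R v u) (farFrom? G R′ w u) imp)

  sphere≤far : ∀ R v X Y → disagreements (sphere G R v) X Y ≤ far R v X Y
  sphere≤far R v X Y = begin
    disagreements (sphere G R v) X Y ≈⟨ ∑-filter (λ u → hasDist? G u v R) V
        (λ {u} d → sym (trans (*-congʳ (𝟙-yes (hasDist? G u v R) d)) (*-identityˡ _)))
        (λ {u} ¬d → trans (*-congʳ (𝟙-no (hasDist? G u v R) ¬d)) (zeroˡ _)) ⟩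
    ∑ V (λ u → 𝟙 (hasDist? G u v R) * neq u X Y) ≤⟨ (∑-mono V λ u →
        *-monoʳ _ (neq-nonNeg u X Y) (𝟙-mono (hasDist? G u v R) (farFrom? G R v u) proj₂)) ⟩
    far R v X Y ∎

  𝟙-far-split : ∀ R v u → 𝟙 (farFrom? G R v u) ≈ 𝟙 (hasDist? G u v R) + 𝟙 (farFrom? G (suc R) v u)
  𝟙-far-split R v u = by-cases (farFrom? G R v u) (walk? G R u v)
    where
    by-cases : (d : Dec (FarFrom G R v u)) → Dec (Walk G R u v) →
               𝟙 (farFrom? G R v u) ≈ 𝟙 (hasDist? G u v R) + 𝟙 (farFrom? G (suc R) v u)
    by-cases (no ¬far) _ = trans (𝟙-no (farFrom? G R v u) ¬far) (sym (trans
      (+-cong (𝟙-no (hasDist? G u v R) λ d → ¬far (proj₂ d))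
              (𝟙-no (farFrom? G (suc R) v u) λ f → ¬far (farFrom-antitone G (ℕ.n≤1+n R) f)))
      (+-identityˡ 0#)))
    by-cases (yes isFar) (yes walk) = trans (𝟙-yes (farFrom? G R v u) isFar) (sym (trans
      (+-cong (𝟙-yes (hasDist? G u v R) (walk , isFar))
              (𝟙-no (farFrom? G (suc R) v u) λ f → f ℕ.≤-refl walk))
      (+-identityʳ 1#)))
    by-cases (yes isFar) (no ¬walk) = trans (𝟙-yes (farFrom? G R v u) isFar) (sym (trans
      (+-cong (𝟙-no (hasDist? G u v R) λ d → ¬walk (proj₁ d))
              (𝟙-yes (farFrom? G (suc R) v u) (farFrom-suc G isFar ¬walk)))
      (+-identityˡ 1#)))

  -- Total variation distance against disagreement probability.

  module _ {Λ : Subset n} (σ τ : PartialConfig q Λ) (𝒞 : Coupling (μ σ) (μ τ)) where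
    open Coupling 𝒞

    marginal₁-𝔼 : ∀ u a → marginal σ u a ≈ 𝔼 (λ X Y → 𝟙 (lookup X u ≟ᶠ a))
    marginal₁-𝔼 u a = ∑-cong cs λ X → trans (*-comm _ _) (trans (*-congʳ (sym (marginal-₁ X))) (∑-*ʳ _ cs _))

    marginal₂-𝔼 : ∀ u a → marginal τ u a ≈ 𝔼 (λ X Y → 𝟙 (lookup Y u ≟ᶠ a))
    marginal₂-𝔼 u a = trans
      (∑-cong cs λ Y → trans (*-comm _ _) (trans (*-congʳ (sym (marginal-₂ Y))) (∑-*ʳ _ cs _)))
      (∑-swap cs cs _)

    dTV≤𝔼-neq : ∀ u → dTV (marginal σ u) (marginal τ u) ≤ 𝔼 (neq u)
    dTV≤𝔼-neq u = begin
      ½ * ∑ (allFin q) (λ a → ∣ marginal σ u a - marginal τ u a ∣) ≤⟨ *-monoˡ ½ 0≤½ (∑-mono (allFin q) deviation) ⟩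
      ½ * ∑ (allFin q) (λ a → 𝔼 (mass a))                         ≈⟨ *-congˡ (sym (𝔼-∑ 𝒞 (allFin q) mass)) ⟩
      ½ * 𝔼 (λ X Y → ∑ (allFin q) λ a → mass a X Y)               ≈⟨ *-congˡ (∑₂-cong λ X Y → *-congˡ (total X Y)) ⟩
      ½ * 𝔼 (λ X Y → 2# * neq u X Y)                              ≈⟨ *-congˡ (𝔼-*ˡ 𝒞 2# (neq u)) ⟩
      ½ * (2# * 𝔼 (neq u))                                        ≈⟨ ½*2x≈x _ ⟩
      𝔼 (neq u)                                                   ∎
      where
      -- A pointwise bound on the difference of the two indicators of the value a. Summed over a, it
      -- counts each disagreement twice, which cancels the ½ in `dTV`.
      mass : Fin q → Config q n → Config q n → Carrier
      mass a X Y = neq u X Y * (𝟙 (lookup X u ≟ᶠ a) + 𝟙 (lookup Y u ≟ᶠ a))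

      split₁ : ∀ a X Y → 𝟙 (lookup X u ≟ᶠ a) ≤ 𝟙 (lookup Y u ≟ᶠ a) + mass a X Y
      split₁ a X Y with lookup X u ≟ᶠ lookup Y u
      ... | yes X≡Y rewrite X≡Y = x≤x+y (Order.reflexive (sym (zeroˡ _)))
      ... | no  _   = Order.trans (x≤x+y (𝟙-nonNeg (lookup Y u ≟ᶠ a)))
        (≤-respʳ (+-congˡ (sym (*-identityˡ _))) (x≤y+x (𝟙-nonNeg (lookup Y u ≟ᶠ a))))

      split₂ : ∀ a X Y → 𝟙 (lookup Y u ≟ᶠ a) ≤ 𝟙 (lookup X u ≟ᶠ a) + mass a X Y
      split₂ a X Y with lookup X u ≟ᶠ lookup Y u
      ... | yes X≡Y rewrite X≡Y = x≤x+y (Order.reflexive (sym (zeroˡ _)))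
      ... | no  _   = Order.trans (x≤y+x (𝟙-nonNeg (lookup X u ≟ᶠ a)))
        (≤-respʳ (+-congˡ (sym (*-identityˡ _))) (x≤y+x (𝟙-nonNeg (lookup X u ≟ᶠ a))))

      deviation : ∀ a → ∣ marginal σ u a - marginal τ u a ∣ ≤ 𝔼 (mass a)
      deviation a = ∣∣-≤
        (x≤y+z⇒x-y≤z (begin
          marginal σ u a                                  ≈⟨ marginal₁-𝔼 u a ⟩
          𝔼 (λ X Y → 𝟙 (lookup X u ≟ᶠ a))                 ≤⟨ 𝔼-mono 𝒞 (split₁ a) ⟩
          𝔼 (λ X Y → 𝟙 (lookup Y u ≟ᶠ a) + mass a X Y)    ≈⟨ 𝔼-+ 𝒞 _ _ ⟩
          𝔼 (λ X Y → 𝟙 (lookup Y u ≟ᶠ a)) + 𝔼 (mass a)    ≈⟨ +-congʳ (marginal₂-𝔼 u a) ⟨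
          marginal τ u a + 𝔼 (mass a)                     ∎))
        (≤-respˡ (sym (-‿anti-homo _ _)) (x≤y+z⇒x-y≤z (begin
          marginal τ u a                                  ≈⟨ marginal₂-𝔼 u a ⟩
          𝔼 (λ X Y → 𝟙 (lookup Y u ≟ᶠ a))                 ≤⟨ 𝔼-mono 𝒞 (split₂ a) ⟩
          𝔼 (λ X Y → 𝟙 (lookup X u ≟ᶠ a) + mass a X Y)    ≈⟨ 𝔼-+ 𝒞 _ _ ⟩
          𝔼 (λ X Y → 𝟙 (lookup X u ≟ᶠ a)) + 𝔼 (mass a)    ≈⟨ +-congʳ (marginal₁-𝔼 u a) ⟨
          marginal σ u a + 𝔼 (mass a)                     ∎)))

      ∑-𝟙 : ∀ b → ∑ (allFin q) (λ a → 𝟙 (b ≟ᶠ a)) ≈ 1#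
      ∑-𝟙 b = trans
        (∑-cong (allFin q) λ a → trans (𝟙-cong (b ≟ᶠ a) (a ≟ᶠ b) ≡.sym ≡.sym) (sym (*-identityʳ _)))
        (∑-delta _≟ᶠ_ (allFin⁺ q) (∈-allFin b) λ _ → 1#)

      total : ∀ X Y → ∑ (allFin q) (λ a → mass a X Y) ≈ 2# * neq u X Y
      total X Y = begin-equality
        ∑ (allFin q) (λ a → mass a X Y)
          ≈⟨ ∑-*ˡ (neq u X Y) (allFin q) _ ⟨
        neq u X Y * ∑ (allFin q) (λ a → 𝟙 (lookup X u ≟ᶠ a) + 𝟙 (lookup Y u ≟ᶠ a))
          ≈⟨ *-congˡ (∑-+ (allFin q) _ _) ⟩
        neq u X Y * (∑ (allFin q) (λ a → 𝟙 (lookup X u ≟ᶠ a)) + ∑ (allFin q) (λ a → 𝟙 (lookup Y u ≟ᶠ a)))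
          ≈⟨ *-congˡ (+-cong (∑-𝟙 (lookup X u)) (trans (∑-𝟙 (lookup Y u)) (sym (+-identityʳ 1#)))) ⟩
        neq u X Y * 2#
          ≈⟨ *-comm _ _ ⟩
        2# * neq u X Y ∎

    ∑-dTV≤𝔼-disagreements : ∀ us → ∑ us (λ u → dTV (marginal σ u) (marginal τ u)) ≤ 𝔼 (disagreements us)
    ∑-dTV≤𝔼-disagreements us = ≤-respʳ (sym (𝔼-∑ 𝒞 us neq)) (∑-mono us dTV≤𝔼-neq)

  module _ (wellDefined : WellDefined) where

    -- Path coupling along single-vertex changes.

    module _ (Λ : Subset n) (R : ℕ) (v : Fin n) (cost : Fin n → Carrier) (cost-nonNeg : ∀ w → 0# ≤ cost w)
             (single : ∀ X Y w → DifferExactlyAt (restrict Λ X) (restrict Λ Y) w →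
                       Σ (Coupling (μ (restrict Λ X)) (μ (restrict Λ Y))) λ 𝒞 → Coupling.𝔼 𝒞 (far R v) ≤ cost w) where

      private
        Bounded : Config q n → Config q n → Carrier → Set _
        Bounded X Y ε = Σ (Coupling (μ (restrict Λ X)) (μ (restrict Λ Y))) λ 𝒞 → Coupling.𝔼 𝒞 (far R v) ≤ ε

        -- For equal pinnings the isolation hypothesis is vacuous, and the deterministic coupling
        -- makes the two samples coincide.
        same : ∀ X Y {ε} → 0# ≤ ε → (∀ u → u ∈ Λ → lookup X u ≡ lookup Y u) → Bounded X Y ε
        same X Y 0≤ε X≡Y = isolatedCoupling wellDefined (restrict Λ X) (restrict Λ Y) isolated ,
          ≤-respˡ (sym (𝔼-isolatedCoupling wellDefined (restrict Λ X) (restrict Λ Y) isolated λ X′ Y′ agree →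
            far-vanish R v X′ Y′ λ u _ → agree u λ u∈Λ → X≡Y u u∈Λ)) 0≤ε
          where
          isolated : ∀ {u w} → (w∈Λ : w ∈ Λ) → lookup X w ≢ lookup Y w → Adj u w → u ∈ Λ
          isolated w∈Λ X≢Y _ = contradiction (X≡Y _ w∈Λ) X≢Y

        move : ∀ w X Y → Dec (lookup X w ≡ lookup Y w) → Dec (w ∈ Λ) →
               Bounded X (X [ w ]≔ lookup Y w) (cost w * neq w X Y)
        move w X Y (yes X≡Y) _ = same X X′ (*-nonNeg (cost-nonNeg w) (neq-nonNeg w X Y)) λ u _ → unchanged u (u ≟ᶠ w)
          where
          X′ = X [ w ]≔ lookup Y w
          unchanged : ∀ u → Dec (u ≡ w) → lookup X u ≡ lookup X′ u
          unchanged u (yes ≡.refl) = ≡.trans X≡Y (≡.sym (lookup∘update w X (lookup Y w)))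
          unchanged u (no u≢w)     = ≡.sym (lookup∘update′ u≢w X (lookup Y w))
        move w X Y (no _) (no w∉Λ) = same X X′ (*-nonNeg (cost-nonNeg w) (neq-nonNeg w X Y)) λ u u∈Λ →
          ≡.sym (lookup∘update′ (λ u≡w → w∉Λ (≡.subst (_∈ Λ) u≡w u∈Λ)) X (lookup Y w))
          where X′ = X [ w ]≔ lookup Y w
        move w X Y (no X≢Y) (yes w∈Λ) = 𝒞 , ≤-respʳ (sym (trans (*-congˡ (neq-≢ w X Y X≢Y)) (*-identityʳ _))) 𝒞≤
          where
          X′ = X [ w ]≔ lookup Y w
          one-change : Bounded X X′ (cost w)
          one-change = single X X′ w
            ( (w∈Λ , λ X≡X′ → X≢Y (≡.trans X≡X′ (lookup∘update w X (lookup Y w))))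
            , λ u _ u≢w → ≡.sym (lookup∘update′ u≢w X (lookup Y w)))
          𝒞 = proj₁ one-change
          𝒞≤ = proj₂ one-change

      -- The vertices of `ws` are switched one at a time from their value in X to that in Y, and the
      -- couplings of consecutive pinnings are glued. Switching a vertex outside Λ leaves the
      -- pinning unchanged and is free.
      pathCoupling : ∀ ws X Y → (∀ u → u ∉ₗ ws → lookup X u ≡ lookup Y u) →
                     Bounded X Y (∑ ws λ w → cost w * neq w X Y)
      pathCoupling []       X Y X≡Y = same X Y Order.refl λ u _ → X≡Y u λ ()
      pathCoupling (w ∷ ws) X Y X≡Y = glue 𝒞₁ 𝒞₂ , (begin
        Coupling.𝔼 (glue 𝒞₁ 𝒞₂) (far R v)
          ≤⟨ 𝔼-glue 𝒞₁ 𝒞₂ (far-triangle R v) ⟩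
        Coupling.𝔼 𝒞₁ (far R v) + Coupling.𝔼 𝒞₂ (far R v)
          ≤⟨ +-mono (proj₂ first) (proj₂ rest) ⟩
        cost w * neq w X Y + ∑ ws (λ w′ → cost w′ * neq w′ X′ Y)
          -- A switch creates no new disagreement with Y, so the remaining costs can be charged to
          -- the disagreements of the original X.
          ≤⟨ +-mono Order.refl (∑-mono ws λ w′ → *-monoˡ _ (cost-nonNeg w′) (closer w′ (w′ ≟ᶠ w))) ⟩
        cost w * neq w X Y + ∑ ws (λ w′ → cost w′ * neq w′ X Y) ∎)
        where
        X′ = X [ w ]≔ lookup Y w

        agree′ : ∀ u → u ∉ₗ ws → Dec (u ≡ w) → lookup X′ u ≡ lookup Y u
        agree′ u u∉ws (yes ≡.refl) = lookup∘update w X (lookup Y w)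
        agree′ u u∉ws (no u≢w)     = ≡.trans (lookup∘update′ u≢w X (lookup Y w)) (X≡Y u λ where
          (here u≡w)   → u≢w u≡w
          (there u∈ws) → u∉ws u∈ws)

        first : Bounded X X′ (cost w * neq w X Y)
        first = move w X Y (lookup X w ≟ᶠ lookup Y w) (w ∈? Λ)

        rest : Bounded X′ Y (∑ ws λ w′ → cost w′ * neq w′ X′ Y)
        rest = pathCoupling ws X′ Y λ u u∉ws → agree′ u u∉ws (u ≟ᶠ w)

        𝒞₁ = proj₁ first
        𝒞₂ = proj₁ rest

        closer : ∀ u → Dec (u ≡ w) → neq u X′ Y ≤ neq u X Y
        closer u (yes ≡.refl) = ≤-respˡ (sym (neq-≡ w X′ Y (lookup∘update w X (lookup Y w)))) (neq-nonNeg w X Y)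
        closer u (no u≢w)     = 𝟙-mono (¬? (lookup X′ u ≟ᶠ lookup Y u)) (¬? (lookup X u ≟ᶠ lookup Y u))
          λ X′≢Y X≡Y → X′≢Y (≡.trans (lookup∘update′ u≢w X (lookup Y w)) X≡Y)

    module _ {Λ : Subset n} (σ τ : PartialConfig q Λ) (𝒞 : Coupling (μ σ) (μ τ)) where
      open Coupling 𝒞

      -- The joint law is bounded by each of its marginals, hence vanishes unless X extends σ and Y
      -- extends τ.
      𝔼-cong-support : ∀ {f g} → (∀ X Y → Extends X σ → Extends Y τ → f X Y ≈ g X Y) → 𝔼 f ≈ 𝔼 g
      𝔼-cong-support {f} {g} f≈g = ∑₂-cong λ X Y → by-cases X Y (extends? X σ) (extends? Y τ)
        where
        null : ∀ X Y → joint X Y ≤ 0# → joint X Y * f X Y ≈ joint X Y * g X Y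
        null X Y joint≤0 = trans (trans (*-congʳ joint≈0) (zeroˡ _)) (sym (trans (*-congʳ joint≈0) (zeroˡ _)))
          where joint≈0 = Order.antisym joint≤0 (nonNeg X Y)

        by-cases : ∀ X Y → Dec (Extends X σ) → Dec (Extends Y τ) → joint X Y * f X Y ≈ joint X Y * g X Y
        by-cases X Y (yes ext) (yes ext′) = *-congˡ (f≈g X Y ext ext′)
        by-cases X Y (no ¬ext) _          = null X Y (≤-respʳ (μ-¬extends wellDefined σ X ¬ext) (joint≤₁ 𝒞 X Y))
        by-cases X Y (yes _)   (no ¬ext)  = null X Y (≤-respʳ (μ-¬extends wellDefined τ Y ¬ext) (joint≤₂ 𝒞 X Y))

      𝔼-neq-≢ : ∀ {v} (v∈Λ : v ∈ Λ) → σ v v∈Λ ≢ τ v v∈Λ → 𝔼 (neq v) ≈ 1#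
      𝔼-neq-≢ {v} v∈Λ σ≢τ = begin-equality
        𝔼 (neq v)       ≈⟨ 𝔼-cong-support (λ X Y ext ext′ → neq-≢ v X Y λ X≡Y →
                             σ≢τ (≡.trans (≡.sym (ext v v∈Λ)) (≡.trans X≡Y (ext′ v v∈Λ)))) ⟩
        𝔼 (λ _ _ → 1#)  ≈⟨ ∑₂-cong (λ X Y → *-identityʳ _) ⟩
        ∑₂ joint        ≈⟨ ∑-cong cs marginal-₁ ⟩
        ∑ cs (μ σ)      ≈⟨ ∑-μ wellDefined σ ⟩
        1#              ∎

      𝔼-neq-≡ : ∀ {u} (u∈Λ : u ∈ Λ) → σ u u∈Λ ≡ τ u u∈Λ → 𝔼 (neq u) ≈ 0#
      𝔼-neq-≡ {u} u∈Λ σ≡τ = begin-equality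
        𝔼 (neq u)       ≈⟨ 𝔼-cong-support (λ X Y ext ext′ → neq-≡ u X Y
                             (≡.trans (ext u u∈Λ) (≡.trans σ≡τ (≡.sym (ext′ u u∈Λ))))) ⟩
        𝔼 (λ _ _ → 0#)  ≈⟨ (∑-zero cs λ X → ∑-zero cs λ Y → zeroʳ _) ⟩
        0#              ∎

    -- Halving the expected disagreement by recursion on the distance.

    module _ (C : Carrier) (independent : CouplingIndependence C) where

      β : ℕ → Carrier
      β R = (2# * C) * ½ ^ ⌈ fromℕ R / (2# * C) ⌉

      Decay : ℕ → Set _
      Decay R = ∀ (Λ : Subset n) (σ τ : PartialConfig q Λ) v → DifferExactlyAt σ τ v →
                Σ (Coupling (μ σ) (μ τ)) λ 𝒞 → Coupling.𝔼 𝒞 (far R v) ≤ β R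

      module _ {Λ : Subset n} (σ τ : PartialConfig q Λ) (v : Fin n) (differ : DifferExactlyAt σ τ v) where

        private
          𝒞₀ : Coupling (μ σ) (μ τ)
          𝒞₀ = proj₁ (independent Λ σ τ (v , differ))

          v∈Λ : v ∈ Λ
          v∈Λ = proj₁ (proj₁ differ)

          d : Fin n → Carrier
          d u = Coupling.𝔼 𝒞₀ (neq u)

          d-nonNeg : ∀ u → 0# ≤ d u
          d-nonNeg u = 𝔼-nonNeg 𝒞₀ (neq-nonNeg u)

          tail shell : ℕ → Carrier
          tail  r = ∑ V λ u → 𝟙 (farFrom? G r v u) * d u
          shell r = ∑ V λ u → 𝟙 (hasDist? G u v r) * d u

          tail-nonNeg : ∀ r → 0# ≤ tail r
          tail-nonNeg r = ∑-nonNeg V λ u → *-nonNeg (𝟙-nonNeg (farFrom? G r v u)) (d-nonNeg u)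

          tail-split : ∀ r → tail r ≈ shell r + tail (suc r)
          tail-split r = trans (∑-cong V λ u → trans (*-congʳ (𝟙-far-split r v u)) (distribʳ _ _ _)) (∑-+ V _ _)

          tail-0≤C : tail 0 ≤ C
          tail-0≤C = begin
            tail 0                    ≤⟨ (∑-mono V λ u → ≤-respʳ (*-identityˡ _) (*-monoʳ _ (d-nonNeg u) (𝟙-≤1 (farFrom? G 0 v u)))) ⟩
            ∑ V d                     ≈⟨ 𝔼-∑ 𝒞₀ V neq ⟨
            Coupling.𝔼 𝒞₀ hamming     ≤⟨ proj₂ (independent Λ σ τ (v , differ)) ⟩
            C                         ∎

          -- The pinned values at v differ, so every coupling disagrees there with probability one.
          -- All lower bounds on C, and hence the invertibility of 2C, come from this.
          1≤shell-0 : 1# ≤ shell 0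
          1≤shell-0 = begin
            1#                           ≈⟨ *-identityˡ 1# ⟨
            1# * 1#                      ≈⟨ *-cong (𝟙-yes (hasDist? G v v 0) (here , λ ())) (𝔼-neq-≢ σ τ 𝒞₀ v∈Λ (proj₂ (proj₁ differ))) ⟨
            𝟙 (hasDist? G v v 0) * d v   ≤⟨ term≤∑ {f = λ u → 𝟙 (hasDist? G u v 0) * d u}
                                              (λ u → *-nonNeg (𝟙-nonNeg (hasDist? G u v 0)) (d-nonNeg u)) (∈-allFin v) ⟩
            shell 0                      ∎

          1+tail-1≤C : 1# + tail 1 ≤ C
          1+tail-1≤C = Order.trans (+-mono 1≤shell-0 Order.refl) (≤-respˡ (tail-split 0) tail-0≤C)

          1≤C : 1# ≤ C
          1≤C = Order.trans (x≤x+y (tail-nonNeg 1)) 1+tail-1≤C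

          0≤C : 0# ≤ C
          0≤C = Order.trans 0≤1 1≤C

          0≤2C : 0# ≤ 2# * C
          0≤2C = *-nonNeg (fromℕ-nonNeg 2) 0≤C

          2C≉0 : ¬ (2# * C ≈ 0#)
          2C≉0 = ≥1⇒≉0 (begin
            1#      ≤⟨ 1≤C ⟩
            C       ≤⟨ x≤x+y 0≤C ⟩
            C + C   ≈⟨ 2*x≈x+x C ⟨
            2# * C  ∎)

          0≤1/2C : 0# ≤ (2# * C) ⁻¹
          0≤1/2C = ⁻¹-nonNeg 0≤2C 2C≉0

          /2C≤1 : ∀ {x} → x ≤ 2# * C → x / (2# * C) ≤ 1#
          /2C≤1 x≤2C = ≤-respʳ (⁻¹-inverse _ 2C≉0) (*-monoʳ _ 0≤1/2C x≤2C)

          -- Shells are disjoint layers of the tail: each heavy one met contributes at least ½ and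
          -- the search continues in the next tail.
          search : ∀ m k → (∃ λ r → k ≤ℕ r × r <ℕ k +ℕ m × shell r ≤ ½) ⊎ fromℕ m * ½ ≤ tail k
          search zero    k = inj₂ (≤-respˡ (sym (zeroˡ ½)) (tail-nonNeg k))
          search (suc m) k with shell k Order.≤? ½
          ... | yes small = inj₁ (k , ℕ.≤-refl , ℕ.m<m+n k (s≤s z≤n) , small)
          ... | no  large with search m (suc k)
          ...   | inj₁ (r , k<r , r< , small) = inj₁ (r , ℕ.<⇒≤ k<r , ≡.subst (r <ℕ_) (≡.sym (ℕ.+-suc k m)) r< , small)
          ...   | inj₂ le = inj₂ (begin
            (1# + fromℕ m) * ½      ≈⟨ distribʳ ½ 1# (fromℕ m) ⟩
            1# * ½ + fromℕ m * ½    ≈⟨ +-congʳ (*-identityˡ ½) ⟩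
            ½ + fromℕ m * ½         ≤⟨ +-mono (≰⇒≥ large) le ⟩
            shell k + tail (suc k)  ≈⟨ tail-split k ⟨
            tail k                  ∎)

          -- The shells up to radius about 2C share total mass at most C, and
          -- v alone already takes 1 of it, so some shell r ≥ 1 has mass ≤ ½.
          lightShell : ∃ λ r → 1 ≤ℕ r × fromℕ r ≤ 2# * C × shell r ≤ ½
          -- The radii from 1 to ⌈2C⌉ - 1 are the positive integers below 2C. Were all of them
          -- heavy, 1 + (⌈2C⌉ - 1)/2 ≤ C would follow, that is ⌈2C⌉ + 1 ≤ 2C, against 2C ≤ ⌈2C⌉.
          lightShell with search (pred ⌈ 2# * C ⌉) 1
          ... | inj₁ (r , 1≤r , r≤m , small) = r , 1≤r , ≰⇒≥ (λ 2C≤r → below (⌈⌉-least r 2C≤r)) , small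
            where
            below : ¬ (⌈ 2# * C ⌉ ≤ℕ r)
            below N≤r with ⌈ 2# * C ⌉
            -- `pred` fixes 0, so here the searched range of radii is empty and 1 ≤ r gives the
            -- contradiction.
            ... | zero  = ℕ.<⇒≱ r≤m 1≤r
            ... | suc m = ℕ.<⇒≱ r≤m N≤r
          ... | inj₂ heavy = contradiction (+-cancelʳ-≤ (fromℕ (suc m)) (begin
            1# + fromℕ (suc m)                ≈⟨ +-assoc 1# 1# (fromℕ m) ⟨
            (1# + 1#) + fromℕ m               ≈⟨ +-cong (sym (trans (*-congʳ (+-congˡ (+-identityʳ 1#))) (*-identityʳ _))) m≈ ⟩
            2# * 1# + 2# * (fromℕ m * ½)      ≈⟨ distribˡ 2# _ _ ⟨
            2# * (1# + fromℕ m * ½)           ≤⟨ *-monoˡ 2# (fromℕ-nonNeg 2) (Order.trans (+-mono Order.refl heavy) 1+tail-1≤C) ⟩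
            2# * C                            ≤⟨ ⌈⌉-upper (2# * C) ⟩
            fromℕ ⌈ 2# * C ⌉                  ≤⟨ fromℕ-mono (n≤suc-pred ⌈ 2# * C ⌉) ⟩
            fromℕ (suc m)                     ≈⟨ +-identityˡ _ ⟨
            0# + fromℕ (suc m)                ∎)) 1≰0
            where
            m = pred ⌈ 2# * C ⌉
            n≤suc-pred : ∀ n → n ≤ℕ suc (pred n)
            n≤suc-pred zero    = z≤n
            n≤suc-pred (suc n) = ℕ.≤-refl
            m≈ : fromℕ m ≈ 2# * (fromℕ m * ½)
            m≈ = sym (trans (x∙yz≈y∙xz _ _ _) (trans (*-congˡ 2*½≈1) (*-identityʳ _)))

          β-nonNeg : ∀ R → 0# ≤ β R
          β-nonNeg R = *-nonNeg 0≤2C (½^-nonNeg ⌈ fromℕ R / (2# * C) ⌉)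

          -- The origin of the prefactor 2C: up to radius 2C the exponent is at most 1, so the bound
          -- is at least 2C · ½, which is C.
          β-base : ∀ R → fromℕ R ≤ 2# * C → C ≤ β R
          β-base R R≤2C = begin
            C                     ≈⟨ ½*2x≈x C ⟨
            ½ * (2# * C)          ≈⟨ *-comm ½ _ ⟩
            (2# * C) * ½          ≈⟨ *-congˡ (*-identityʳ ½) ⟨
            (2# * C) * ½ ^ 1      ≤⟨ *-monoˡ _ 0≤2C (½^-antitone (⌈⌉-least 1 (≤-respʳ (sym (+-identityʳ 1#)) (/2C≤1 R≤2C)))) ⟩
            β R                   ∎

          -- Since r/(2C) ≤ 1, passing from `R ∸ r` to R raises the ceiling by at most one, and the
          -- spare ½ pays for that.
          β-step : ∀ {r R} → r ≤ℕ R → fromℕ r ≤ 2# * C → β (R ∸ r) * ½ ≤ β R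
          β-step {r} {R} r≤R r≤2C = begin
            (2# * C) * ½ ^ t * ½      ≈⟨ *-assoc _ _ _ ⟩
            (2# * C) * (½ ^ t * ½)    ≈⟨ *-congˡ (*-comm _ _) ⟩
            (2# * C) * ½ ^ suc t      ≤⟨ *-monoˡ _ 0≤2C (½^-antitone (⌈⌉-least (suc t) bound)) ⟩
            β R                       ∎
            where
            t = ⌈ fromℕ (R ∸ r) / (2# * C) ⌉
            bound : fromℕ R / (2# * C) ≤ fromℕ (suc t)
            bound = begin
              fromℕ R / (2# * C)                               ≡⟨ ≡.cong (λ k → fromℕ k / (2# * C)) (m∸n+n≡m r≤R) ⟨
              fromℕ (R ∸ r +ℕ r) / (2# * C)                    ≈⟨ *-congʳ (fromℕ-+ (R ∸ r) r) ⟩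
              (fromℕ (R ∸ r) + fromℕ r) / (2# * C)             ≈⟨ distribʳ _ _ _ ⟩
              fromℕ (R ∸ r) / (2# * C) + fromℕ r / (2# * C)    ≤⟨ +-mono (⌈⌉-upper _) (/2C≤1 r≤2C) ⟩
              fromℕ t + 1#                                     ≈⟨ +-comm _ _ ⟩
              fromℕ (suc t)                                    ∎

        module _ {r R : ℕ} (r≤R : r ≤ℕ R) (recurse : Decay (R ∸ r)) where
          private
            ball Λ′ : Subset n
            ball = select λ u → ¬? (farFrom? G (suc r) v u)
            Λ′   = Λ ∪ ball

            Λ⊆Λ′ : Λ ⊆ Λ′
            Λ⊆Λ′ = p⊆p∪q ball

            -- The second term charges pinned vertices beyond the ball, where the
            -- samples of 𝒞₀ never differ.
            sphereCost outerCost cost : Fin n → Carrier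
            sphereCost w = 𝟙 (hasDist? G w v r) * β (R ∸ r)
            outerCost  w = 𝟙 (farFrom? G (suc r) v w ×-dec w ∈? Λ) * C
            cost w = sphereCost w + outerCost w

            sphereCost-nonNeg : ∀ w → 0# ≤ sphereCost w
            sphereCost-nonNeg w = *-nonNeg (𝟙-nonNeg (hasDist? G w v r)) (β-nonNeg (R ∸ r))

            outerCost-nonNeg : ∀ w → 0# ≤ outerCost w
            outerCost-nonNeg w = *-nonNeg (𝟙-nonNeg (farFrom? G (suc r) v w ×-dec w ∈? Λ)) 0≤C

            cost-nonNeg : ∀ w → 0# ≤ cost w
            cost-nonNeg w = +-nonNeg (sphereCost-nonNeg w) (outerCost-nonNeg w)

            -- The two decisions tell whether the distance from w to v is above, equal to or below
            -- r. The first case can arise only for w in Λ, since Λ′ adds nothing outside the ball.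
            single : ∀ X Y w → DifferExactlyAt (restrict Λ′ X) (restrict Λ′ Y) w →
                     Dec (FarFrom G (suc r) v w) → Dec (FarFrom G r v w) →
                     Σ (Coupling (μ (restrict Λ′ X)) (μ (restrict Λ′ Y))) λ 𝒞 → Coupling.𝔼 𝒞 (far R v) ≤ cost w
            single X Y w diff (yes beyond) _ = proj₁ coupled , (begin
              Coupling.𝔼 (proj₁ coupled) (far R v)  ≤⟨ 𝔼-mono (proj₁ coupled) (far≤hamming R v) ⟩
              Coupling.𝔼 (proj₁ coupled) hamming    ≤⟨ proj₂ coupled ⟩
              C                                     ≈⟨ *-identityˡ C ⟨
              1# * C                                ≈⟨ *-congʳ (𝟙-yes (farFrom? G (suc r) v w ×-dec w ∈? Λ) (beyond , w∈Λ)) ⟨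
              outerCost w                           ≤⟨ x≤y+x (sphereCost-nonNeg w) ⟩
              cost w                                ∎)
              where
              coupled = independent Λ′ (restrict Λ′ X) (restrict Λ′ Y) (w , diff)
              w∈Λ : w ∈ Λ
              w∈Λ with x∈p∪q⁻ Λ ball (proj₁ (proj₁ diff))
              ... | inj₁ w∈Λ    = w∈Λ
              ... | inj₂ w∈ball = ⊥-elim (∈-select⁻ (λ u → ¬? (farFrom? G (suc r) v u)) w∈ball beyond)
            single X Y w diff (no within) (yes far-r) = proj₁ coupled , (begin
              Coupling.𝔼 (proj₁ coupled) (far R v)        ≤⟨ 𝔼-mono (proj₁ coupled) (far-mono {R} {R ∸ r} {v} {w} (farFrom-shift G r≤R walk)) ⟩
              Coupling.𝔼 (proj₁ coupled) (far (R ∸ r) w)  ≤⟨ proj₂ coupled ⟩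
              β (R ∸ r)                                   ≈⟨ *-identityˡ _ ⟨
              1# * β (R ∸ r)                              ≈⟨ *-congʳ (𝟙-yes (hasDist? G w v r) (walk , far-r)) ⟨
              sphereCost w                                ≤⟨ x≤x+y (outerCost-nonNeg w) ⟩
              cost w                                      ∎)
              where
              coupled = recurse Λ′ (restrict Λ′ X) (restrict Λ′ Y) w diff
              walk : Walk G r w v
              walk = decidable-stable (walk? G r w v) λ ¬walk → within (farFrom-suc G far-r ¬walk)
            -- All neighbours of w are within distance r of v, hence pinned in Λ′, so w is isolated
            -- from the free vertices. As r ≤ R, w itself is not among the counted vertices.
            single X Y w diff (no _) (no inside) =
              isolatedCoupling wellDefined (restrict Λ′ X) (restrict Λ′ Y) isolated ,
              ≤-respˡ (sym (𝔼-isolatedCoupling wellDefined (restrict Λ′ X) (restrict Λ′ Y) isolated λ X′ Y′ agree →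
                far-vanish R v X′ Y′ λ u far-u → agree u λ u∈Λ′ → proj₂ diff u u∈Λ′ λ where
                  ≡.refl → inside (farFrom-antitone G r≤R far-u)))
                (cost-nonNeg w)
              where
              isolated : ∀ {u w′} → (w′∈Λ′ : w′ ∈ Λ′) → lookup X w′ ≢ lookup Y w′ → Adj u w′ → u ∈ Λ′
              isolated {u} {w′} w′∈Λ′ X≢Y uw′ = x∈p∪q⁺ (inj₂ (∈-select⁺ (λ u → ¬? (farFrom? G (suc r) v u)) λ far-u →
                inside (≡.subst (FarFrom G r v) w′≡w (farFrom-adjacent G uw′ far-u))))
                where
                w′≡w : w′ ≡ w
                w′≡w = decidable-stable (w′ ≟ᶠ w) λ w′≢w → X≢Y (proj₂ diff w′ w′∈Λ′ w′≢w)

            path : ∀ X Y → Σ (Coupling (μ (restrict Λ′ X)) (μ (restrict Λ′ Y))) λ 𝒞 →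
                           Coupling.𝔼 𝒞 (far R v) ≤ ∑ V λ w → cost w * neq w X Y
            path X Y = pathCoupling Λ′ R v cost cost-nonNeg
              (λ X Y w diff → single X Y w diff (farFrom? G (suc r) v w) (farFrom? G r v w))
              V X Y λ u u∉V → contradiction (∈-allFin u) u∉V

            outer-vanish : ∀ w → outerCost w * d w ≈ 0#
            outer-vanish w with farFrom? G (suc r) v w ×-dec w ∈? Λ
            ... | no _ = trans (*-congʳ (zeroˡ C)) (zeroˡ _)
            ... | yes (beyond , w∈Λ) = trans (*-congˡ (𝔼-neq-≡ σ τ 𝒞₀ w∈Λ (proj₂ differ w w∈Λ λ where
                ≡.refl → farFrom-self G beyond))) (zeroʳ _)

            cost-d : ∀ w → cost w * d w ≈ β (R ∸ r) * (𝟙 (hasDist? G w v r) * d w)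
            cost-d w = begin-equality
              cost w * d w                                    ≈⟨ distribʳ _ _ _ ⟩
              sphereCost w * d w + outerCost w * d w          ≈⟨ +-congˡ (outer-vanish w) ⟩
              sphereCost w * d w + 0#                         ≈⟨ +-identityʳ _ ⟩
              𝟙 (hasDist? G w v r) * β (R ∸ r) * d w          ≈⟨ *-congʳ (*-comm _ _) ⟩
              β (R ∸ r) * 𝟙 (hasDist? G w v r) * d w          ≈⟨ *-assoc _ _ _ ⟩
              β (R ∸ r) * (𝟙 (hasDist? G w v r) * d w)        ∎

          resampledCoupling : Coupling (μ σ) (μ τ)
          resampledCoupling = resample
            (μ-stationary wellDefined Λ⊆Λ′ σ) (μ-stationary wellDefined Λ⊆Λ′ τ) 𝒞₀ (λ X Y → proj₁ (path X Y))

          -- By linearity the path costs are weighted by the probabilities with which 𝒞₀ disagrees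
          -- at each vertex, and after `outer-vanish` only the sphere of radius r contributes.
          𝔼-resampledCoupling : Coupling.𝔼 resampledCoupling (far R v) ≤ β (R ∸ r) * shell r
          𝔼-resampledCoupling = begin
            Coupling.𝔼 resampledCoupling (far R v)
              ≈⟨ 𝔼-resample (μ-stationary wellDefined Λ⊆Λ′ σ) (μ-stationary wellDefined Λ⊆Λ′ τ) 𝒞₀ (λ X Y → proj₁ (path X Y)) (far R v) ⟩
            Coupling.𝔼 𝒞₀ (λ X Y → Coupling.𝔼 (proj₁ (path X Y)) (far R v))
              ≤⟨ 𝔼-mono 𝒞₀ (λ X Y → proj₂ (path X Y)) ⟩
            Coupling.𝔼 𝒞₀ (λ X Y → ∑ V λ w → cost w * neq w X Y)
              ≈⟨ 𝔼-∑ 𝒞₀ V (λ w X Y → cost w * neq w X Y) ⟩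
            ∑ V (λ w → Coupling.𝔼 𝒞₀ (λ X Y → cost w * neq w X Y))
              ≈⟨ (∑-cong V λ w → 𝔼-*ˡ 𝒞₀ (cost w) (neq w)) ⟩
            ∑ V (λ w → cost w * d w)
              ≈⟨ ∑-cong V cost-d ⟩
            ∑ V (λ w → β (R ∸ r) * (𝟙 (hasDist? G w v r) * d w))
              ≈⟨ ∑-*ˡ _ V _ ⟨
            β (R ∸ r) * shell r ∎

        decay-step : ∀ R → (∀ {R′} → R′ <ℕ R → Decay R′) →
          Σ (Coupling (μ σ) (μ τ)) λ 𝒞 → Coupling.𝔼 𝒞 (far R v) ≤ β R
        decay-step R recurse with fromℕ R Order.≤? 2# * C
        ... | yes R≤2C = 𝒞₀ , (begin
          Coupling.𝔼 𝒞₀ (far R v)  ≤⟨ 𝔼-mono 𝒞₀ (far≤hamming R v) ⟩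
          Coupling.𝔼 𝒞₀ hamming    ≤⟨ proj₂ (independent Λ σ τ (v , differ)) ⟩
          C                        ≤⟨ β-base R R≤2C ⟩
          β R                      ∎)
        ... | no R≰2C with lightShell
        ...   | r , 1≤r , r≤2C , light = resampledCoupling r≤R rec , (begin
          Coupling.𝔼 (resampledCoupling r≤R rec) (far R v)  ≤⟨ 𝔼-resampledCoupling r≤R rec ⟩
          β (R ∸ r) * shell r                              ≤⟨ *-monoˡ _ (β-nonNeg (R ∸ r)) light ⟩
          β (R ∸ r) * ½                                    ≤⟨ β-step r≤R r≤2C ⟩
          β R                                              ∎)
          where
          -- As R exceeds 2C and r does not, `R ∸ r` is an honest subtraction; 1 ≤ r makes it
          -- strictly smaller than R.
          r≤R : r ≤ℕ R
          r≤R = ℕ.≰⇒≥ λ R≤r → R≰2C (Order.trans (fromℕ-mono R≤r) r≤2C)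
          rec : Decay (R ∸ r)
          rec = recurse (∸-monoʳ-< 1≤r r≤R)

      decay : ∀ R → Decay R
      decay = <-rec Decay λ R recurse Λ σ τ v differ → decay-step σ τ v differ R recurse

      sphere-decay : ∀ R (Λ : Subset n) (σ τ : PartialConfig q Λ) v → DifferExactlyAt σ τ v →
                     Σ (Coupling (μ σ) (μ τ)) λ 𝒞 → Coupling.𝔼 𝒞 (disagreements (sphere G R v)) ≤ β R
      sphere-decay R Λ σ τ v differ with decay R Λ σ τ v differ
      ... | 𝒞 , 𝒞≤β = 𝒞 , Order.trans (𝔼-mono 𝒞 (sphere≤far R v)) 𝒞≤β

      total-influence-decay : TotalInfluenceDecay (λ x → (2# * C) * ½ ^ ⌈ x / (2# * C) ⌉)
      total-influence-decay Λ σ τ v differ R _ with sphere-decay R Λ σ τ v differ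
      ... | 𝒞 , 𝒞≤β = Order.trans (∑-dTV≤𝔼-disagreements σ τ 𝒞 (sphere G R v)) 𝒞≤β

theorem3p2 : ∀ {c ℓ₁ ℓ₂} (K : ArchimedeanOrderedField c ℓ₁ ℓ₂) {n q : ℕ}
    (G : Graph n) (S : SpinSystem K q) →
    let open ArchimedeanOrderedField K
        open Gibbs K G S
    in
    WellDefined →
    (C : Carrier) → CouplingIndependence C →
    ((R : ℕ) → R > 0 →
      (Λ : Subset n) (σ τ : PartialConfig q Λ) (v : Fin n) → DifferExactlyAt σ τ v →
      Σ (Coupling (μ σ) (μ τ)) λ 𝒞 →
        Coupling.𝔼 𝒞 (disagreements (sphere G R v))
          ≤ (2# * C) * ½ ^ ⌈ fromℕ R / (2# * C) ⌉)
    × TotalInfluenceDecay (λ x → (2# * C) * ½ ^ ⌈ x / (2# * C) ⌉)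
theorem3p2 K G S wellDefined C independent =
  (λ R _ → sphere-decay wellDefined C independent R) , total-influence-decay wellDefined C independent
  where open DisagreementDecay K G S
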